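{- Let $K_3$ be the triangle (the complete undirected graph on three vertices without loops). Then $\mathrm{CSP}(K_3)$ is not Datalog$^\cup$-reducible to $\mathrm{CSP}(\mathbf{OR}_{\mathrm{T}}[\mathbb{Z}_2^{[3]},\mathbb{Z}_3^{[3]}])$.
   Context: All structures are finite relational structures. $\mathrm{CSP}(\mathbf{A})$ is the class of finite structures over the vocabulary of $\mathbf{A}$ that admit a homomorphism to $\mathbf{A}$; any finite structure over that vocabulary is an instance. For a finite group $\Gamma$ and $r\ge1$, $\Gamma^{[r]}$ is the structure with universe $\Gamma$ and one $r$-ary relation for each right coset $\Delta\delta$ of each subgroup $\Delta\leq\Gamma^r$. Tractable or-construction: for nonempty $\tau_i$-structures $\mathbf{A}_i$ ($i=1,2$) with disjoint vocabularies and disjoint universes, fresh elements $c_1,c_2$ and a fresh binary symbol $S$, $\mathbf{OR}_{\mathrm{T}}[\mathbf{A}_1,\mathbf{A}_2]$ is the structure over $\tau_1\cup\tau_2\cup\{S\}$ with universe $A_1\cup A_2\cup\{c_1,c_2\}$, with $R$ interpreted as $R^{\mathbf{A}_i}\cup\{(c_i,\dots,c_i)\}$ for $R\in\tau_i$, and $S$ interpreted as $(A_1\times\{c_2\})\cup(\{c_1\}\times A_2)$. Datalog$^\cup$-reductions: Structures may be many-sorted (finitely many sorts with disjoint domains; each relation symbol has a sequence of sorts as its arity); ordinary structures have one sort. A Datalog program is a finite set of rules $P_0(\bar x_0)\leftarrow P_1(\bar x_1),\dots,P_m(\bar x_m)$, where $P_0$ is an intensional (defined) predicate, the $P_j$ with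 $j\ge1$ are relation symbols of the input vocabulary or intensional predicates (no negation, no inequality), with a designated output predicate, evaluated by its least fixed point. A (congruence-free) Datalog interpretation $\phi$ from $\sigma$-structures to many-sorted $\tau'$-structures consists of a Datalog program $\phi_t$ for each sort $t$ of $\tau'$, whose output on $\mathbf{B}$ is a set of tuples of elements of $\mathbf{B}$ of some fixed length $d_t$ and fixed sorts, and a Datalog program $\phi_R$ for each symbol $R\in\tau'$ of arity $(t_1,\dots,t_r)$ whose output has length $d_{t_1}+\dots+d_{t_r}$; the structure $\phi(\mathbf{B})$ has as domain of sort $t$ (a copy of) the output of $\phi_t$ on $\mathbf{B}$, and $R^{\phi(\mathbf{B})}$ consists of the tuples $(\bar a_1,\dots,\bar a_r)$ of domain elements of the respective sorts whose concatenation is in the output of $\phi_R$. A union gadget from vocabulary $\tau'$ to vocabulary $\tau$ is given by a map $d$ from the sorts of $\tau'$ to the sorts of $\tau$ and a map $\rho$ from the symbols of $\tau'$ to the symbols of $\tau$ such that the arity of $\rho(R)$ is the image under $d$ of the arity of $R$; it maps $\mathbf{C}$ to the $\tau$-structure whose domain of sort $s$ is the disjoint union of the domains of $\mathbf{C}$ of sorts $t$ with $d(t)=s$, and whose relation $R$ is the union of all $Q^{\mathbf{C}}$ with $\rho(Q)=R$. $\mathrm{CSP}(\mathbf{A}_1)$ is Datalog$^\cup$-reducible to $\mathrm{CSP}(\mathbf{A}_2)$ if there is a composition $\psi$ of a Datalog interpretation followed by a union gadget, mapping instances of $\mathrm{CSP}(\mathbf{A}_1)$ to instances of $\mathrm{CSP}(\mathbf{A}_2)$,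 such that for all instances $\mathbf{B}$ of $\mathrm{CSP}(\mathbf{A}_1)$: $\mathbf{B}\in\mathrm{CSP}(\mathbf{A}_1)$ iff $\psi(\mathbf{B})\in\mathrm{CSP}(\mathbf{A}_2)$. -}

module Defs where

open import Algebra.Bundles using (Group)
open import Algebra.Structures using (IsGroup)
import Algebra.Construct.Pointwise as Pointwise
open import Data.Fin.Base using (Fin; toℕ; funToFin)
open import Data.Fin.Properties using (toℕ-injective; toℕ-fromℕ<; toℕ<n; toℕ≤n)
open import Data.Fin.Subset using (Subset) renaming (_∈_ to _∈ˢ_)
open import Data.List.Base using (List; []; _∷_; map; concatMap; tabulate)
open import Data.List.Membership.Propositional using (_∈_)
open import Data.List.Relation.Unary.All as All using (All; []; _∷_)
open import Data.List.Relation.Unary.All.Properties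
  using (map⁺; concat⁺; tabulate⁻)
open import Data.Nat.Base using (ℕ; NonZero; _+_; _∸_; _^_; _%_; >-nonZero⁻¹)
open import Data.Nat.DivMod
  using (_mod_; m%n<n; %-distribˡ-+; m<n⇒m%n≡m; n%n≡0)
import Data.Nat.Properties as ℕ
open import Data.Product.Base using (Σ-syntax; ∃-syntax; _×_; _,_)
open import Data.Refinement using (Refinement-syntax; value)
open import Data.Unit.Base using (⊤; tt)
open import Function.Bundles using (_↔_; _⇔_)
open import Level using (0ℓ)
open import Relation.Binary.Definitions using (_Respects_)
open import Relation.Binary.PropositionalEquality
  using (_≡_; _≢_; refl; sym; trans; cong; cong₂; subst; isEquivalence;
         module ≡-Reasoning)
open import Relation.Nullary using (Dec)
open import Relation.Unary using (Pred)

private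
  variable
    S S₁ S₂ : Set

-- S is the set of sorts; ordinary (one-sorted) vocabularies have S = ⊤.
record Vocabulary (S : Set) : Set₁ where
  field
    Symbol : Set
    arity  : Symbol → List S

open Vocabulary public

-- A tuple of sorts t₁ … tᵣ over D is an element of All D (t₁ ∷ … ∷ tᵣ ∷ []).
record Structure (τ : Vocabulary S) : Set₁ where
  field
    Dom : S → Set
    Rel : (R : Symbol τ) → All Dom (arity τ R) → Set

open Structure public

IsFiniteSet : Set → Set
IsFiniteSet A = ∃[ n ] (A ↔ Fin n)

-- Decidability of the relations is what makes them (constructively) finite
-- sets of tuples.
record IsFinite {τ : Vocabulary S} (B : Structure τ) : Set where
  field
    dom-finite : ∀ s → IsFiniteSet (Dom B s)
    rel?       : ∀ R xs → Dec (Rel B R xs)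

record Hom {τ : Vocabulary S} (A B : Structure τ) : Set where
  field
    fun      : ∀ {s} → Dom A s → Dom B s
    preserve : ∀ R xs → Rel A R xs → Rel B R (All.map fun xs)

-- The instances are the finite structures; finiteness of B is imposed where
-- instances are quantified over.
CSP : {τ : Vocabulary S} → Structure τ → Structure τ → Set
CSP A B = Hom B A

module _ {S : Set} (σ : Vocabulary S) where

  -- A program declares the list of the arities of its intensional predicates;
  -- a predicate of arity us is a position of us in this list.  Likewise, a
  -- variable of sort s is a position of s in the list of the sorts of the
  -- variables of the rule.
  data Atom (idbs : List (List S)) (vars : List S) : Set where
    edb : (R : Symbol σ) → All (_∈ vars) (arity σ R) → Atom idbs vars
    idb : ∀ {us} → us ∈ idbs → All (_∈ vars) us → Atom idbs vars

  -- A rule is universally closed over vars.  Head variables need not occur in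
  -- the body.
  record Rule (idbs : List (List S)) : Set where
    field
      vars      : List S
      {arity₀}  : List S
      head      : arity₀ ∈ idbs
      head-args : All (_∈ vars) arity₀
      body      : List (Atom idbs vars)

  record Program (out : List S) : Set where
    field
      idbs   : List (List S)
      rules  : List (Rule idbs)
      output : out ∈ idbs

open Rule public
open Program public

module _ {S : Set} {σ : Vocabulary S} (B : Structure σ) where

  instantiate : ∀ {vars us} → All (Dom B) vars → All (_∈ vars) us →
                All (Dom B) us
  instantiate ν = All.map (All.lookup ν)

  module _ {idbs : List (List S)} (rs : List (Rule σ idbs)) where

    mutual

      -- The least fixed point: a tuple is in it iff finitely many
      -- rule applications derive it.
      data Derivable : ∀ {us} → us ∈ idbs → All (Dom B) us → Set where
        apply : ∀ {r} → r ∈ rs → (ν : All (Dom B) (vars r)) →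
                All (Satisfied ν) (body r) →
                Derivable (head r) (instantiate ν (head-args r))

      data Satisfied {vars} (ν : All (Dom B) vars) : Atom σ idbs vars → Set where
        edb : ∀ {R xs} → Rel B R (instantiate ν xs) → Satisfied ν (edb R xs)
        idb : ∀ {us} {P : us ∈ idbs} {xs} →
              Derivable P (instantiate ν xs) → Satisfied ν (idb P xs)

  Output : ∀ {out} → Program σ out → All (Dom B) out → Set
  Output P = Derivable (rules P) (output P)

record Interpretation (σ : Vocabulary S₁) (τ : Vocabulary S₂) : Set where
  field
    dim      : S₂ → List S₁
    domain   : (t : S₂) → Program σ (dim t)
    relation : (R : Symbol τ) → Program σ (concatMap dim (arity τ R))

-- Refinement types carry their proofs irrelevantly, so the domain of sort t has
-- exactly one element for each tuple in the output of the program, however many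
-- derivations that tuple has.
interpret : {σ : Vocabulary S₁} {τ : Vocabulary S₂} →
            Interpretation σ τ → Structure σ → Structure τ
interpret φ B = record
  { Dom = λ t → [ x ∈ All (Dom B) (dim t) ∣ Output B (domain t) x ]
  ; Rel = λ R xs → Output B (relation R) (concat⁺ (map⁺ (All.map value xs)))
  }
  where open Interpretation φ

record UnionGadget (τ′ : Vocabulary S₁) (τ : Vocabulary S₂) : Set where
  field
    d       : S₁ → S₂
    ρ       : Symbol τ′ → Symbol τ
    arity-ρ : ∀ Q → arity τ (ρ Q) ≡ map d (arity τ′ Q)

module _ {τ′ : Vocabulary S₁} {τ : Vocabulary S₂}
         (u : UnionGadget τ′ τ) (C : Structure τ′) where
  open UnionGadget u

  data UnionDom : S₂ → Set where
    inj : ∀ {t} → Dom C t → UnionDom (d t)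

  data UnionRel : (R : Symbol τ) → All UnionDom (arity τ R) → Set where
    inj : ∀ {Q} {xs : All (Dom C) (arity τ′ Q)} → Rel C Q xs →
          UnionRel (ρ Q)
            (subst (All UnionDom) (sym (arity-ρ Q)) (map⁺ (All.map inj xs)))

  union : Structure τ
  union = record { Dom = UnionDom ; Rel = UnionRel }

record Reduction (σ : Vocabulary S₁) (τ : Vocabulary S₂) : Set₁ where
  field
    {Sort}          : Set
    sort-finite     : IsFiniteSet Sort
    vocabulary      : Vocabulary Sort
    symbol-finite   : IsFiniteSet (Symbol vocabulary)
    interpretation  : Interpretation σ vocabulary
    gadget          : UnionGadget vocabulary τ

reduce : {σ : Vocabulary S₁} {τ : Vocabulary S₂} →
         Reduction σ τ → Structure σ → Structure τ
reduce ψ B = union gadget (interpret interpretation B)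
  where open Reduction ψ

-- reduce ψ B is automatically finite when B is.
DatalogUnionReducible : {σ : Vocabulary S₁} {τ : Vocabulary S₂} →
                        Structure σ → Structure τ → Set₁
DatalogUnionReducible {σ = σ} {τ} A₁ A₂ =
  Σ[ ψ ∈ Reduction σ τ ]
    (∀ B → IsFinite B → CSP A₁ B ⇔ CSP A₂ (reduce ψ B))

data OrSymbol (Sym₁ Sym₂ : Set) : Set where
  sym₁ : Sym₁ → OrSymbol Sym₁ Sym₂
  sym₂ : Sym₂ → OrSymbol Sym₁ Sym₂
  symS : OrSymbol Sym₁ Sym₂

data OrDom (A₁ A₂ : Set) : Set where
  in₁   : A₁ → OrDom A₁ A₂
  in₂   : A₂ → OrDom A₁ A₂
  c₁ c₂ : OrDom A₁ A₂

orVocabulary : Vocabulary ⊤ → Vocabulary ⊤ → Vocabulary ⊤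
orVocabulary τ₁ τ₂ = record
  { Symbol = OrSymbol (Symbol τ₁) (Symbol τ₂)
  ; arity  = λ where
      (sym₁ R) → arity τ₁ R
      (sym₂ R) → arity τ₂ R
      symS     → tt ∷ tt ∷ []
  }

module _ {τ₁ τ₂ : Vocabulary ⊤} (A₁ : Structure τ₁) (A₂ : Structure τ₂) where

  OR-Dom : ⊤ → Set
  OR-Dom _ = OrDom (Dom A₁ tt) (Dom A₂ tt)

  data OR-Rel : (R : Symbol (orVocabulary τ₁ τ₂)) →
                All OR-Dom (arity (orVocabulary τ₁ τ₂) R) → Set where
    rel₁   : ∀ {R xs} → Rel A₁ R xs → OR-Rel (sym₁ R) (All.map in₁ xs)
    const₁ : ∀ {R} → OR-Rel (sym₁ R) (All.universal (λ _ → c₁) (arity τ₁ R))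
    rel₂   : ∀ {R xs} → Rel A₂ R xs → OR-Rel (sym₂ R) (All.map in₂ xs)
    const₂ : ∀ {R} → OR-Rel (sym₂ R) (All.universal (λ _ → c₂) (arity τ₂ R))
    S-fst  : ∀ {a} → OR-Rel symS (in₁ a ∷ c₂ ∷ [])
    S-snd  : ∀ {a} → OR-Rel symS (c₁ ∷ in₂ a ∷ [])

  OR[_,_] : Structure (orVocabulary τ₁ τ₂)
  OR[_,_] = record { Dom = OR-Dom ; Rel = OR-Rel }

record IsSubgroup (G : Group 0ℓ 0ℓ) (P : Pred (Group.Carrier G) 0ℓ) : Set where
  open Group G
  field
    resp      : P Respects _≈_
    ε-closed  : P ε
    ∙-closed  : ∀ {x y} → P x → P y → P (x ∙ y)
    ⁻¹-closed : ∀ {x} → P x → P (x ⁻¹)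

record FiniteGroup : Set where
  field
    order   : ℕ
    _∙_     : Fin order → Fin order → Fin order
    ε       : Fin order
    _⁻¹     : Fin order → Fin order
    isGroup : IsGroup _≡_ _∙_ ε _⁻¹

  group : Group 0ℓ 0ℓ
  group = record { isGroup = isGroup }

module _ (Γ : FiniteGroup) (r : ℕ) where
  open FiniteGroup Γ using (order; group)

  power : Group 0ℓ 0ℓ
  power = Pointwise.group (Fin r) group

  -- Subsets of Γʳ are coded by subsets of Fin (order ^ r), using the bijection
  -- funToFin between (Fin r → Fin order) and Fin (order ^ r); thus equal
  -- subsets have equal codes.
  ⟦_⟧ : Subset (order ^ r) → Pred (Fin r → Fin order) 0ℓ
  ⟦ X ⟧ x = funToFin x ∈ˢ X

  IsRightCoset : Subset (order ^ r) → Set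
  IsRightCoset X =
    ∃[ Δ ] IsSubgroup power ⟦ Δ ⟧ ×
    ∃[ δ ] (∀ x → ⟦ X ⟧ x ⇔ (∃[ γ ] ⟦ Δ ⟧ γ × x ≈ γ ∙ δ))
    where open Group power

  cosetVocabulary : Vocabulary ⊤
  cosetVocabulary = record
    { Symbol = [ X ∈ Subset (order ^ r) ∣ IsRightCoset X ]
    ; arity  = λ _ → tabulate {n = r} (λ _ → tt)
    }

  _^[_] : Structure cosetVocabulary
  _^[_] = record
    { Dom = λ _ → Fin order
    ; Rel = λ X xs → ⟦ value X ⟧ (tabulate⁻ xs)
    }

module _ (n : ℕ) .{{_ : NonZero n}} where

  private
    _⊕_ : Fin n → Fin n → Fin n
    x ⊕ y = (toℕ x + toℕ y) mod n

    0# : Fin n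
    0# = 0 mod n

    ⊖_ : Fin n → Fin n
    ⊖ x = (n ∸ toℕ x) mod n

    toℕ-mod : ∀ m → toℕ (m mod n) ≡ m % n
    toℕ-mod m = toℕ-fromℕ< (m%n<n m n)

    mod-cong : ∀ {k m} → k % n ≡ m % n → k mod n ≡ m mod n
    mod-cong {k} {m} eq =
      toℕ-injective (trans (toℕ-mod k) (trans eq (sym (toℕ-mod m))))

    toℕ-mod-id : ∀ x → toℕ x mod n ≡ x
    toℕ-mod-id x = toℕ-injective (trans (toℕ-mod _) (m<n⇒m%n≡m (toℕ<n x)))

    ⊕-mod : ∀ k m → (k mod n) ⊕ (m mod n) ≡ (k + m) mod n
    ⊕-mod k m = mod-cong (begin
      (toℕ (k mod n) + toℕ (m mod n)) % n ≡⟨ cong₂ (λ a b → (a + b) % n) (toℕ-mod k) (toℕ-mod m) ⟩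
      (k % n + m % n) % n                 ≡⟨ %-distribˡ-+ k m n ⟨
      (k + m) % n                         ∎)
      where open ≡-Reasoning

    ⊕-comm : ∀ x y → x ⊕ y ≡ y ⊕ x
    ⊕-comm x y = cong (_mod n) (ℕ.+-comm (toℕ x) (toℕ y))

    ⊕-assoc : ∀ x y z → (x ⊕ y) ⊕ z ≡ x ⊕ (y ⊕ z)
    ⊕-assoc x y z = begin
      (x ⊕ y) ⊕ z                     ≡⟨ cong ((x ⊕ y) ⊕_) (toℕ-mod-id z) ⟨
      (x ⊕ y) ⊕ (toℕ z mod n)         ≡⟨ ⊕-mod (toℕ x + toℕ y) (toℕ z) ⟩
      (toℕ x + toℕ y + toℕ z) mod n   ≡⟨ cong (_mod n) (ℕ.+-assoc (toℕ x) (toℕ y) (toℕ z)) ⟩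
      (toℕ x + (toℕ y + toℕ z)) mod n ≡⟨ ⊕-mod (toℕ x) (toℕ y + toℕ z) ⟨
      (toℕ x mod n) ⊕ (y ⊕ z)         ≡⟨ cong (_⊕ (y ⊕ z)) (toℕ-mod-id x) ⟩
      x ⊕ (y ⊕ z)                     ∎
      where open ≡-Reasoning

    ⊕-identityˡ : ∀ x → 0# ⊕ x ≡ x
    ⊕-identityˡ x = begin
      0# ⊕ x             ≡⟨ cong (0# ⊕_) (toℕ-mod-id x) ⟨
      0# ⊕ (toℕ x mod n) ≡⟨ ⊕-mod 0 (toℕ x) ⟩
      toℕ x mod n        ≡⟨ toℕ-mod-id x ⟩
      x                  ∎
      where open ≡-Reasoning

    ⊕-inverseˡ : ∀ x → (⊖ x) ⊕ x ≡ 0#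
    ⊕-inverseˡ x = begin
      (⊖ x) ⊕ x                 ≡⟨ cong ((⊖ x) ⊕_) (toℕ-mod-id x) ⟨
      (⊖ x) ⊕ (toℕ x mod n)     ≡⟨ ⊕-mod (n ∸ toℕ x) (toℕ x) ⟩
      (n ∸ toℕ x + toℕ x) mod n ≡⟨ cong (_mod n) (ℕ.m∸n+n≡m (toℕ≤n x)) ⟩
      n mod n                   ≡⟨ mod-cong (trans (n%n≡0 n) (sym (m<n⇒m%n≡m (>-nonZero⁻¹ n)))) ⟩
      0#                        ∎
      where open ≡-Reasoning

  ℤ/ : FiniteGroup
  ℤ/ = record
    { order   = n
    ; _∙_     = _⊕_
    ; ε       = 0#
    ; _⁻¹     = ⊖_
    ; isGroup = record
      { isMonoid = record
        { isSemigroup = record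
          { isMagma = record { isEquivalence = isEquivalence ; ∙-cong = cong₂ _⊕_ }
          ; assoc   = ⊕-assoc
          }
        ; identity = ⊕-identityˡ , λ x → trans (⊕-comm x 0#) (⊕-identityˡ x)
        }
      ; inverse = ⊕-inverseˡ , λ x → trans (⊕-comm x (⊖ x)) (⊕-inverseˡ x)
      ; ⁻¹-cong = cong ⊖_
      }
    }

graphVocabulary : Vocabulary ⊤
graphVocabulary = record { Symbol = ⊤ ; arity = λ _ → tt ∷ tt ∷ [] }

K₃ : Structure graphVocabulary
K₃ = record
  { Dom = λ _ → Fin 3
  ; Rel = λ { _ (x ∷ y ∷ []) → x ≢ y }
  }

module Submission where

-- A reduction ψ is refuted on a graph whose vertices are functions from the hole of a pigeon to three
-- colours, adjacent when they differ under every injective placement of their pigeons.  If there are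
-- more pigeons than holes, it is not 3-colourable, because a colouring selects a hole for each pigeon.
-- But few vertices are coloured by any injective placement of the few pigeons involved, and Datalog
-- sees only few vertices at a time.  So, given h : ψ(K₃) → OR, each element z of ψ(graph) gets a value
-- in OR for each injective placement of its support, compatibly with the relations, and it remains
-- to average these values over the placements.
--
-- Both groups have the Mal'cev operation x y⁻¹ z, which preserves cosets.  Whenever pigeons i < j share
-- a hole, replace the value at that placement by the Mal'cev combination of its values after moving
-- i, both, or j to new holes.  This does not affect functions that ignore i or j, hence for a function
-- of few pigeons only the pairs among these matter, and after iterating over all pairs it is evaluated
-- at placements that are injective on these pigeons only.
--
-- OR is the disjoint union of A₁ ∪ {c₂} and {c₁} ∪ A₂, and only within one of these halves are the
-- relations preserved by a Mal'cev operation.  Fixing the pigeons in the support of z in advance forces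
-- all values of z into one half.  If z and w are related, their values always lie in the same half, so
-- the first partial placement that decides the half is the same for both and can be used for both.

open import Defs
open import Algebra.Bundles using (Group)
import Algebra.Properties.Group as GroupProperties
open import Data.Bool.Base using (Bool; true; false; T; if_then_else_)
import Data.Bool.Properties as Bool
open import Data.Empty using (⊥-elim)
open import Data.Fin.Base as Fin
  using (Fin; zero; suc; toℕ; fromℕ<; combine; quotient; remQuot; finToFun; funToFin)
open import Data.Fin.Patterns using (0F; 1F; 2F)
import Data.Fin.Properties as Fin
open import Data.Fin.Subset using () renaming (_∈_ to _∈ˢ_)
import Data.Fin.Subset.Properties as Subset
open import Data.Irrelevant as Irrelevant using ([_])
open import Data.List.Base as List
  using (List; []; _∷_; _++_; length; map; foldr; filter; concatMap; allFin; cartesianProduct)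
open import Data.List.Extrema.Nat using (max; xs≤max)
import Data.List.Membership.DecPropositional as DecMembership
open import Data.List.Membership.Propositional using (_∈_; _∉_; lose)
open import Data.List.Membership.Propositional.Properties
  using (∈-map⁺; ∈-++⁺ˡ; ∈-++⁺ʳ; ∈-++⁻; ∈-allFin; ∈-cartesianProduct⁺; ∈-filter⁺)
open import Data.List.Properties using (length-map; filter-notAll; ≡-dec)
open import Data.List.Relation.Binary.Subset.Propositional using (_⊆_)
open import Data.List.Relation.Unary.All as All using (All; []; _∷_)
open import Data.List.Relation.Unary.All.Properties
  using (lookup-map; map⁺; map⁻; ++⁺; concat⁺; tabulate⁻)
open import Data.List.Relation.Unary.Any as Any using (here; there)
open import Data.List.Relation.Unary.Any.Properties using (lookup-index)
open import Data.Maybe.Base as Maybe using (Maybe; just; nothing; maybe′)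
open import Data.Nat.Base
  using (ℕ; zero; suc; _+_; _*_; _^_; _≤_; _<_; _<ᵇ_; s≤s; z≤n; s≤s⁻¹; nonZero)
import Data.Nat.Properties as ℕ
open import Data.Product.Base using (∃-syntax; _×_; _,_; proj₁; proj₂)
open import Data.Product.Function.NonDependent.Propositional using (_×-↔_)
open import Data.Refinement as Refinement using (value)
open import Data.Sum.Base using (_⊎_; inj₁; inj₂; [_,_]′)
import Data.Sum.Properties as Sum
open import Data.Unit.Base using (⊤; tt)
open import Data.Vec.Functional using (updateAt)
open import Data.Vec.Functional.Properties using (updateAt-updates; updateAt-minimal)
open import Function.Base using (_∘_; const)
open import Function.Bundles using (Equivalence; Inverse; mk⇔)
open import Function.Construct.Composition using (_↔-∘_)
open import Function.Construct.Identity using (↔-id)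
open import Function.Construct.Symmetry using (↔-sym)
open import Level using (0ℓ)
open import Relation.Binary.Definitions using (tri<; tri≈; tri>)
open import Relation.Binary.PropositionalEquality
  using (_≡_; _≢_; _≗_; refl; sym; trans; cong; cong₂; subst; ≢-sym)
import Relation.Binary.Reasoning.Setoid as SetoidReasoning
open import Relation.Nullary
  using (Dec; yes; no; does; ¬_; ¬?; contradiction; _×-dec_; _⊎-dec_; _→-dec_)
open import Relation.Nullary.Decidable
  using (decidable-stable; dec-true; does-⇔; map′; recompute; toWitness)
open import Relation.Nullary.Reflects using (Reflects; invert)

private
  variable
    m n : ℕ
    A : Set

-- Partial injections

infix 4 _∈?_
_∈?_ : (i : Fin n) (s : List (Fin n)) → Dec (i ∈ s)
_∈?_ = DecMembership._∈?_ Fin._≟_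

fresh : (l : List (Fin n)) → length l < n → ∃[ u ] u ∉ l
fresh {n} l l<n with Fin.any? (λ u → ¬? (u ∈? l))
... | yes p = p
... | no ∄u = contradiction u≡v (Fin.<⇒≢ (proj₁ (proj₂ (proj₂ collision))))
  where
  u∈l : ∀ u → u ∈ l
  u∈l u = decidable-stable (u ∈? l) (λ u∉l → ∄u (u , u∉l))
  collision = Fin.pigeonhole l<n (Any.index ∘ u∈l)
  u = proj₁ collision
  v = proj₁ (proj₂ collision)
  u≡v : u ≡ v
  u≡v = trans (lookup-index (u∈l u))
    (trans (cong (List.lookup l) (proj₂ (proj₂ (proj₂ collision)))) (sym (lookup-index (u∈l v))))

infix 4 _≈[_]_
_≈[_]_ : (Fin m → A) → List (Fin m) → (Fin m → A) → Set
f ≈[ s ] g = ∀ {i} → i ∈ s → f i ≡ g i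

InjectiveOn : List (Fin m) → (Fin m → A) → Set
InjectiveOn s f = ∀ {i j} → i ∈ s → j ∈ s → f i ≡ f j → i ≡ j

module _ {f g : Fin m → A} {s : List (Fin m)} where

  injectiveOn-resp : f ≈[ s ] g → InjectiveOn s f → InjectiveOn s g
  injectiveOn-resp f≈g f-inj i∈s j∈s eq =
    f-inj i∈s j∈s (trans (f≈g i∈s) (trans eq (sym (f≈g j∈s))))

injectiveOn? : (s : List (Fin m)) (f : Fin m → Fin n) → Dec (InjectiveOn s f)
injectiveOn? s f with Fin.all? (λ i → Fin.all? λ j →
  (i ∈? s) →-dec (j ∈? s) →-dec (f i Fin.≟ f j) →-dec (i Fin.≟ j))
... | yes p = yes (λ {i} {j} → p i j)
... | no ¬p = no (λ f-inj → ¬p (λ i j → f-inj))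

injectiveOn-∷ : ∀ {s i u} {f : Fin m → Fin n} → i ∉ s → u ∉ map f s → InjectiveOn s f →
                InjectiveOn (i ∷ s) (updateAt f i (const u))
injectiveOn-∷ {s = s} {i} {u} {f} i∉s u∉fs f-inj = λ where
    (here refl) (here refl) _ → refl
    (here refl) (there k∈s) eq → contradiction
      (subst (_∈ map f s) (trans (sym (old k∈s)) (trans (sym eq) new)) (∈-map⁺ f k∈s)) u∉fs
    (there j∈s) (here refl) eq → contradiction
      (subst (_∈ map f s) (trans (sym (old j∈s)) (trans eq new)) (∈-map⁺ f j∈s)) u∉fs
    (there j∈s) (there k∈s) eq → f-inj j∈s k∈s (trans (sym (old j∈s)) (trans eq (old k∈s)))
  where
  new : updateAt f i (const u) i ≡ u
  new = updateAt-updates i f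
  old : updateAt f i (const u) ≈[ s ] f
  old {j} j∈s = updateAt-minimal j i f λ { refl → i∉s j∈s }

extend : ∀ (s t : List (Fin m)) (f : Fin m → Fin n) → length t + length s ≤ n →
         InjectiveOn s f → ∃[ g ] g ≈[ s ] f × InjectiveOn (t ++ s) g
extend s [] f _ f-inj = f , (λ _ → refl) , f-inj
extend s (i ∷ t) f b f-inj with i ∈? s
... | yes i∈s =
  let g , g≈f , g-inj = extend s t f (ℕ.<⇒≤ b) f-inj
      drop : (i ∷ t) ++ s ⊆ t ++ s
      drop = λ { (here refl) → ∈-++⁺ʳ t i∈s ; (there p) → p }
  in g , g≈f , λ p q → g-inj (drop p) (drop q)
... | no i∉s =
  let u , u∉ = fresh (map f s) (ℕ.≤-trans
        (s≤s (ℕ.≤-trans (ℕ.≤-reflexive (length-map f s)) (ℕ.m≤n+m _ (length t)))) b)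
      g , g≈ , g-inj = extend (i ∷ s) t (updateAt f i (const u))
        (ℕ.≤-trans (ℕ.≤-reflexive (ℕ.+-suc (length t) (length s))) b) (injectiveOn-∷ i∉s u∉ f-inj)
      move : (i ∷ t) ++ s ⊆ t ++ i ∷ s
      move = λ where
        (here refl) → ∈-++⁺ʳ t (here refl)
        (there p) → [ ∈-++⁺ˡ , ∈-++⁺ʳ t ∘ there ]′ (∈-++⁻ t p)
  in g
   , (λ {j} j∈s → trans (g≈ (there j∈s)) (updateAt-minimal j i f λ { refl → i∉s j∈s }))
   , λ p q → g-inj (move p) (move q)

-- Averaging over placements by collision splitting

record Malcev (H : Set) : Set where
  field
    op     : H → H → H → H
    xyy≡x  : ∀ x y → op x y y ≡ x
    yyz≡z  : ∀ y z → op y y z ≡ z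

record Closed {H : Set} (M : Malcev H) {I : Set} (Λ : (I → H) → Set) : Set where
  open Malcev M
  field
    resp   : ∀ {u v} → u ≗ v → Λ u → Λ v
    closed : ∀ {u v w} → Λ u → Λ v → Λ w → Λ (λ i → op (u i) (v i) (w i))

DependsOn : {A H : Set} → List (Fin m) → ((Fin m → A) → H) → Set
DependsOn s φ = ∀ {f g} → f ≈[ s ] g → φ f ≡ φ g

-- Holes are the nodes of the binary tree; the list is the path from the node up to the root.
Node : Set
Node = List (Fin 2)

-- The subtree order: as lists run from a node up to the root, the ancestors of `w` are its
-- suffixes.
data _⊑_ (h : Node) : Node → Set where
  here  : h ⊑ h
  there : ∀ {d w} → h ⊑ w → h ⊑ (d ∷ w)

⊑-length : ∀ {h w} → h ⊑ w → length h ≤ length w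
⊑-length here      = ℕ.≤-refl
⊑-length (there p) = ℕ.m≤n⇒m≤1+n (⊑-length p)

∷⋢ : ∀ {d} h → ¬ (d ∷ h) ⊑ h
∷⋢ h p = ℕ.1+n≰n (⊑-length p)

⊑-uncons : ∀ {d h w} → (d ∷ h) ⊑ w → h ⊑ w
⊑-uncons here      = there here
⊑-uncons (there p) = there (⊑-uncons p)

infix 4 _≟ᴺ_
_≟ᴺ_ : (h w : Node) → Dec (h ≡ w)
_≟ᴺ_ = ≡-dec Fin._≟_

opp : Fin 2 → Fin 2
opp 0F = 1F
opp 1F = 0F

opp≢ : ∀ d → opp d ≢ d
opp≢ 0F ()
opp≢ 1F ()

updateAt-cong : ∀ {s : List (Fin m)} {f g : Fin m → A} i {h} →
                f ≈[ s ] g → updateAt f i h ≈[ s ] updateAt g i h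
updateAt-cong {f = f} {g} i {h} f≈g {j} j∈s with j Fin.≟ i
... | yes refl = trans (updateAt-updates i f) (trans (cong h (f≈g j∈s)) (sym (updateAt-updates i g)))
... | no j≢i   = trans (updateAt-minimal j i f j≢i)
                   (trans (f≈g j∈s) (sym (updateAt-minimal j i g j≢i)))

updateAt-outside : ∀ {s : List (Fin m)} {f : Fin m → A} {i h} → i ∉ s → updateAt f i h ≈[ s ] f
updateAt-outside {f = f} {i} i∉s {j} j∈s = updateAt-minimal j i f λ { refl → i∉s j∈s }

module _ {m : ℕ} where

  Config : Set
  Config = Fin m → Node

  Pair : Set
  Pair = Fin m × Fin m

  collide? : (p : Pair) (c : Config) → Dec (proj₁ p Fin.< proj₂ p × c (proj₁ p) ≡ c (proj₂ p))
  collide? (i , j) c = (i Fin.<? j) ×-dec (c i ≟ᴺ c j)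

  moveˡ moveʳ moveˡʳ : Pair → Config → Config
  moveˡ (i , j) c = updateAt c i (0F ∷_)
  moveʳ (i , j) c = updateAt c j (1F ∷_)
  moveˡʳ p c = moveʳ p (moveˡ p c)

  allPairs : List Pair
  allPairs = cartesianProduct (allFin m) (allFin m)

  module _ {H : Set} (M : Malcev H) where
    open Malcev M

    -- If φ ignores i, then moveˡʳ can be replaced by moveʳ and the result is φ c by xyy≡x; if φ ignores
    -- j, use yyz≡z.
    step : Pair → (Config → H) → Config → H
    step p φ c with collide? p c
    ... | yes _ = op (φ (moveˡ p c)) (φ (moveˡʳ p c)) (φ (moveʳ p c))
    ... | no _  = φ c

    passes : ℕ → (Config → H) → Config → H
    passes zero    φ = φ
    -- The head of `allPairs` ends up outermost, so it acts on the configuration first. One pass is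
    -- not enough: a later move can make an already processed pair collide again, one level deeper.
    passes (suc r) φ = foldr step (passes r φ) allPairs

  module _ (s : List (Fin m)) where

    Inside : Pair → Set
    Inside (i , j) = i ∈ s × j ∈ s

    module _ {H : Set} (M : Malcev H) where
      open Malcev M

      step-outside : ∀ {φ} p → DependsOn s φ → ¬ Inside p → ∀ c → step M p φ c ≡ φ c
      step-outside {φ} p@(i , j) loc out c with collide? p c
      ... | no _ = refl
      ... | yes _ with i ∈? s | j ∈? s
      ... | yes i∈s | yes j∈s = contradiction (i∈s , j∈s) out
      ... | no i∉s  | _       = trans
              (cong (λ x → op (φ (moveˡ p c)) x (φ (moveʳ p c))) (loc (updateAt-cong j (updateAt-outside i∉s))))
              (trans (xyy≡x _ _) (loc (updateAt-outside i∉s)))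
      ... | yes _   | no j∉s  = trans
              (cong (λ x → op (φ (moveˡ p c)) x (φ (moveʳ p c))) (loc (updateAt-outside j∉s)))
              (trans (yyz≡z _ _) (loc (updateAt-outside j∉s)))

      step-local : ∀ {φ} p → DependsOn s φ → DependsOn s (step M p φ)
      step-local {φ} p@(i , j) loc {c} {c′} c≈ with i ∈? s | j ∈? s
      ... | no i∉s | _ = trans (step-outside p loc (i∉s ∘ proj₁) c)
            (trans (loc c≈) (sym (step-outside p loc (i∉s ∘ proj₁) c′)))
      ... | yes _ | no j∉s = trans (step-outside p loc (j∉s ∘ proj₂) c)
            (trans (loc c≈) (sym (step-outside p loc (j∉s ∘ proj₂) c′)))
      ... | yes i∈s | yes j∈s with collide? p c | collide? p c′
      ... | yes _ | yes _ rewrite loc {moveˡ p c} (updateAt-cong i c≈)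
                                | loc {moveʳ p c} (updateAt-cong j c≈)
                                | loc {moveˡʳ p c} (updateAt-cong j (updateAt-cong i c≈)) = refl
      ... | yes (i<j , eq) | no ¬q = contradiction (i<j , trans (sym (c≈ i∈s)) (trans eq (c≈ j∈s))) ¬q
      ... | no ¬q | yes (i<j , eq) = contradiction (i<j , trans (c≈ i∈s) (trans eq (sym (c≈ j∈s)))) ¬q
      ... | no _ | no _ = loc c≈

      run-local : ∀ {φ} ps → DependsOn s φ → DependsOn s (foldr (step M) φ ps)
      run-local []       loc = loc
      run-local (p ∷ ps) loc = step-local p (run-local ps loc)

      passes-local : ∀ {φ} r → DependsOn s φ → DependsOn s (passes M r φ)
      passes-local zero    loc = loc
      passes-local (suc r) loc = run-local allPairs (passes-local r loc)

    Beyond : Fin 2 → Fin m → Fin m → Set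
    Beyond 0F x y = x Fin.< y
    Beyond 1F x y = y Fin.< x

    Beyond-trans : ∀ d {x y z} → Beyond d x y → Beyond d y z → Beyond d x z
    Beyond-trans 0F p q = Fin.<-trans p q
    Beyond-trans 1F p q = Fin.<-trans q p

    -- A pigeon enters a left subtree only by colliding with a larger one, and a right subtree by
    -- colliding with a smaller one, and some such pigeon stays outside.  This bounds the depth by the size of s.
    Witnessed : Config → Set
    Witnessed c = ∀ {x} → x ∈ s → ∀ d h → (d ∷ h) ⊑ c x →
      ∃[ y ] y ∈ s × h ⊑ c y × ¬ (d ∷ h) ⊑ c y × Beyond d x y

    -- Each step from `h` down to `d ∷ h` deletes from `t` a witness, which lies below `h` but
    -- outside the smaller subtree. So every level costs one pigeon.
    depth-bound : ∀ {c} → Witnessed c → ∀ {x} → x ∈ s → ∀ h → h ⊑ c x →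
      ∃[ t ] length t + length h ≤ length s × (∀ {y} → y ∈ s → h ⊑ c y → y ∈ t)
    depth-bound W x∈s [] _ = s , ℕ.≤-reflexive (ℕ.+-identityʳ _) , λ y∈s _ → y∈s
    depth-bound {c} W x∈s (d ∷ h) p =
      let y , y∈s , h⊑y , ⋢y , _ = W x∈s d h p
          t , t≤ , sub = depth-bound W x∈s h (⊑-uncons p)
          shorter = filter-notAll (λ z → ¬? (z Fin.≟ y)) t (lose (sub y∈s h⊑y) (λ z≢y → z≢y refl))
      in filter (λ z → ¬? (z Fin.≟ y)) t
       , ℕ.≤-trans (ℕ.≤-reflexive (ℕ.+-suc _ (length h))) (ℕ.≤-trans (ℕ.+-monoˡ-≤ (length h) shorter) t≤)
       , λ {z} z∈s q → ∈-filter⁺ (λ z → ¬? (z Fin.≟ y)) (sub z∈s (⊑-uncons q)) λ { refl → ⋢y q }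

    depth< : ∀ {c} → Witnessed c → ∀ {x} → x ∈ s → length (c x) < length s
    depth< {c} W {x} x∈s with depth-bound {c} W x∈s (c x) here
    -- The list still contains `x`; this makes the bound strict.
    ... | _ ∷ t , t≤ , _ = ℕ.≤-trans (s≤s (ℕ.m≤n+m _ (length t))) t≤
    ... | [] , _ , sub with () ← sub x∈s here

    member : Pair → Fin 2 → Fin m
    member (i , j) 0F = i
    member (i , j) 1F = j

    -- A common description of the three moves, so that the invariants are checked only once.
    -- `member p d` is the pigeon that may enter child `d` of the shared node.
    record Split (p : Pair) (c c′ : Config) : Set where
      field
        {source} : Node
        before   : ∀ d → c (member p d) ≡ source
        dest     : ∀ d → c′ (member p d) ≡ source ⊎ c′ (member p d) ≡ d ∷ source
        moved    : ∃[ d ] c′ (member p d) ≡ d ∷ source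
        fixed    : ∀ {x} → x ≢ member p 0F → x ≢ member p 1F → c′ x ≡ c x

      change : ∀ x → c′ x ≡ c x ⊎ ∃[ d ] x ≡ member p d × c′ x ≡ d ∷ source
      change x with x Fin.≟ member p 0F | x Fin.≟ member p 1F
      ... | yes refl | _        =
            [ (λ e → inj₁ (trans e (sym (before 0F)))) , (λ e → inj₂ (0F , refl , e)) ]′ (dest 0F)
      ... | no _     | yes refl =
            [ (λ e → inj₁ (trans e (sym (before 1F)))) , (λ e → inj₂ (1F , refl , e)) ]′ (dest 1F)
      ... | no x≢i | no x≢j = inj₁ (fixed x≢i x≢j)

    module _ {i j : Fin m} {c : Config} (i<j : i Fin.< j) (eq : c i ≡ c j) where

      private
        p : Pair
        p = i , j

        i≢j : i ≢ j
        i≢j = Fin.<⇒≢ i<j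

      split-moveˡ : Split p c (moveˡ p c)
      split-moveˡ = record
        { before = λ { 0F → refl ; 1F → sym eq }
        ; dest   = λ { 0F → inj₂ (updateAt-updates i c)
                     ; 1F → inj₁ (trans (updateAt-minimal j i c (≢-sym i≢j)) (sym eq)) }
        ; moved  = 0F , updateAt-updates i c
        ; fixed  = λ x≢i _ → updateAt-minimal _ i c x≢i }

      split-moveʳ : Split p c (moveʳ p c)
      split-moveʳ = record
        { before = λ { 0F → refl ; 1F → sym eq }
        ; dest   = λ { 0F → inj₁ (updateAt-minimal i j c i≢j)
                     ; 1F → inj₂ (trans (updateAt-updates j c) (cong (1F ∷_) (sym eq))) }
        ; moved  = 1F , trans (updateAt-updates j c) (cong (1F ∷_) (sym eq))
        ; fixed  = λ _ x≢j → updateAt-minimal _ j c x≢j }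

      split-moveˡʳ : Split p c (moveˡʳ p c)
      split-moveˡʳ = record
        { before = λ { 0F → refl ; 1F → sym eq }
        ; dest   = λ { 0F → inj₂ atˡ
                     ; 1F → inj₂ (trans (updateAt-updates j c′)
                              (cong (1F ∷_) (trans (updateAt-minimal j i c (≢-sym i≢j)) (sym eq)))) }
        ; moved  = 0F , atˡ
        ; fixed  = λ x≢i x≢j → trans (updateAt-minimal _ j c′ x≢j) (updateAt-minimal _ i c x≢i) }
        where
        c′ = moveˡ p c
        atˡ = trans (updateAt-minimal i j c′ i≢j) (updateAt-updates i c)

    module _ {p : Pair} {c c′ : Config} (i<j : proj₁ p Fin.< proj₂ p) (p⊆s : Inside p)
             (sp : Split p c c′) where
      open Split sp

      private
        member∈s : ∀ d → member p d ∈ s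
        member∈s 0F = proj₁ p⊆s
        member∈s 1F = proj₂ p⊆s

        beyond-partner : ∀ d → Beyond d (member p d) (member p (opp d))
        beyond-partner 0F = i<j
        beyond-partner 1F = i<j

        -- Whether the other pigeon stays at `source` or enters the opposite child, it is below
        -- `source` and outside child `d`.
        partner : ∀ d {x} → Beyond d x (member p (opp d)) →
          ∃[ y ] y ∈ s × source ⊑ c′ y × ¬ (d ∷ source) ⊑ c′ y × Beyond d x y
        partner d b with dest (opp d)
        ... | inj₁ e = _ , member∈s (opp d) , subst (source ⊑_) (sym e) here
                     , (λ q → ∷⋢ _ (subst (_ ⊑_) e q)) , b
        ... | inj₂ e = _ , member∈s (opp d) , subst (source ⊑_) (sym e) (there here)
                     , (λ q → not-below (subst (_ ⊑_) e q)) , b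
          where
          not-below′ : ∀ {e} → e ≢ d → ¬ (d ∷ source) ⊑ (e ∷ source)
          not-below′ ne here      = ne refl
          not-below′ ne (there q) = ∷⋢ _ q
          not-below = not-below′ (opp≢ d)

        -- An old witness fails only if it has just moved into the subtree `d ∷ h` itself. Its
        -- collision partner then replaces it, being still further beyond `x` on the same side.
        kept : Witnessed c → ∀ {x} → x ∈ s → ∀ d h → (d ∷ h) ⊑ c x →
          ∃[ y ] y ∈ s × h ⊑ c′ y × ¬ (d ∷ h) ⊑ c′ y × Beyond d x y
        kept W x∈s d h q with W x∈s d h q
        ... | y , y∈s , h⊑ , ⋢ , b with change y
        ... | inj₁ e = y , y∈s , subst (h ⊑_) (sym e) h⊑ , (λ q → ⋢ (subst (_ ⊑_) e q)) , b
        ... | inj₂ (d′ , refl , e) with (d ∷ h) ≟ᴺ (d′ ∷ source)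
        ... | yes refl = partner d (Beyond-trans d b (beyond-partner d))
        ... | no ne = y , y∈s , subst (h ⊑_) (sym e) (there (subst (h ⊑_) (before d′) h⊑))
                    , (λ q → lower (subst ((d ∷ h) ⊑_) e q)) , b
          where
          lower : ¬ (d ∷ h) ⊑ (d′ ∷ source)
          lower here      = ne refl
          lower (there q) = ⋢ (subst ((d ∷ h) ⊑_) (sym (before d′)) q)

      split-witnessed : Witnessed c → Witnessed c′
      split-witnessed W {x} x∈s d h q with change x
      ... | inj₁ e = kept W x∈s d h (subst ((d ∷ h) ⊑_) e q)
      ... | inj₂ (d′ , refl , e) with subst ((d ∷ h) ⊑_) e q
      -- Only the child just entered needs a new witness; any larger subtree already contained
      -- `source`.
      ... | here    = partner d (beyond-partner d)
      ... | there q = kept W x∈s d h (subst ((d ∷ h) ⊑_) (sym (before d′)) q)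

    module _ (k : ℕ) where

      -- During a pass, ps are the pairs still to be processed and r is the number of later passes.
      Delayed : ℕ → List Pair → Config → Set
      Delayed r ps c = ∀ {x y} → x ∈ s → y ∈ s → x Fin.< y → c x ≡ c y →
        k ≤ length (c x) + r ⊎ (x , y) ∈ ps × k ≤ length (c x) + suc r

      delayed-skip : ∀ {r p ps c} → ¬ (Inside p × proj₁ p Fin.< proj₂ p × c (proj₁ p) ≡ c (proj₂ p)) →
                     Delayed r (p ∷ ps) c → Delayed r ps c
      delayed-skip out del x∈s y∈s x<y eq with del x∈s y∈s x<y eq
      ... | inj₁ b = inj₁ b
      ... | inj₂ (here refl , b) = contradiction ((x∈s , y∈s) , x<y , eq) out
      ... | inj₂ (there q , b) = inj₂ (q , b)

      module _ {r : ℕ} {p : Pair} {ps : List Pair} {c c′ : Config} (p⊆s : Inside p)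
               (i<j : proj₁ p Fin.< proj₂ p) (sp : Split p c c′) (del : Delayed r (p ∷ ps) c) where
        open Split sp

        private
          deeper : ∀ {z d} → c′ z ≡ d ∷ source → k ≤ length (c′ z) + r
          deeper {z} e rewrite e with del (proj₁ p⊆s) (proj₂ p⊆s) i<j (trans (before 0F) (sym (before 1F)))
          ... | inj₁ b       rewrite before 0F = ℕ.m≤n⇒m≤1+n b
          ... | inj₂ (_ , b) rewrite before 0F = ℕ.≤-trans b (ℕ.≤-reflexive (ℕ.+-suc _ r))

          not-fixed : ¬ (∀ d → c′ (member p d) ≡ c (member p d))
          not-fixed fix = let d , e = moved in
            ∷⋢ source (subst ((d ∷ source) ⊑_) (trans (sym e) (trans (fix d) (before d))) here)

        -- A collision involving a moved pigeon takes place one level below `source`, which gains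
        -- the missing unit of depth. A collision of two unmoved pigeons is old, and it is not `p`,
        -- because some member of `p` moved.
        delayed-split : Delayed r ps c′
        delayed-split {x} {y} x∈s y∈s x<y eq with change x | change y
        ... | inj₂ (_ , _ , e) | _ = inj₁ (deeper e)
        ... | inj₁ _ | inj₂ (_ , _ , e) = inj₁ (subst (λ w → k ≤ length w + r) (sym eq) (deeper e))
        ... | inj₁ e | inj₁ e′ with del x∈s y∈s x<y (trans (sym e) (trans eq e′))
        ... | inj₁ b = inj₁ (subst (λ w → k ≤ length w + r) (sym e) b)
        ... | inj₂ (there q , b) = inj₂ (q , subst (λ w → k ≤ length w + suc r) (sym e) b)
        ... | inj₂ (here refl , b) = contradiction (λ { 0F → e ; 1F → e′ }) not-fixed

      module _ {H : Set} (M : Malcev H) {I : Set} {Λ : (I → H) → Set} (cl : Closed M Λ) where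
        open Closed cl

        -- Pairs that leave `s` or do not collide are skipped. A collision inside `s` branches into
        -- the three moves, each preserving both invariants, and `closed` recombines the results.
        run-closed : ∀ {r} {ψ : I → Config → H} → (∀ i → DependsOn s (ψ i)) →
          (∀ {c} → Witnessed c → Delayed r [] c → Λ (λ i → ψ i c)) →
          ∀ ps {c} → Witnessed c → Delayed r ps c → Λ (λ i → foldr (step M) (ψ i) ps c)
        run-closed loc base [] W del = base W del
        run-closed {r} {ψ} loc base (p@(i , j) ∷ ps) {c} W del with i ∈? s | j ∈? s
        ... | no i∉s | _ = resp (λ x → sym (step-outside M p (run-local M ps (loc x)) (i∉s ∘ proj₁) c))
                             (run-closed loc base ps W (delayed-skip (i∉s ∘ proj₁ ∘ proj₁) del))
        ... | yes _ | no j∉s = resp (λ x → sym (step-outside M p (run-local M ps (loc x)) (j∉s ∘ proj₂) c))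
                             (run-closed loc base ps W (delayed-skip (j∉s ∘ proj₂ ∘ proj₁) del))
        ... | yes i∈s | yes j∈s with collide? p c
        ... | no ¬q = run-closed loc base ps W (delayed-skip (¬q ∘ proj₂) del)
        ... | yes (i<j , eq) =
              closed (after (split-moveˡ i<j eq)) (after (split-moveˡʳ i<j eq)) (after (split-moveʳ i<j eq))
          where
          after : ∀ {c′} → Split p c c′ → Λ (λ x → foldr (step M) (ψ x) ps c′)
          after sp = run-closed loc base ps (split-witnessed i<j (i∈s , j∈s) sp W)
                       (delayed-split (i∈s , j∈s) i<j sp del)

        passes-closed : ∀ {ψ : I → Config → H} → (∀ i → DependsOn s (ψ i)) →
          (∀ {c} → Witnessed c → Delayed 0 [] c → Λ (λ i → ψ i c)) →
          ∀ r {c} → Witnessed c → Delayed r [] c → Λ (λ i → passes M r (ψ i) c)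
        passes-closed loc base zero    W del = base W del
        passes-closed loc base (suc r) W del =
          run-closed (λ i → passes-local M r (loc i)) (passes-closed loc base r) allPairs W
            -- At the start of a pass all pairs are pending, so every collision may use the weaker
            -- bound.
            λ {x} {y} x∈s y∈s x<y eq → inj₂
              ( ∈-cartesianProduct⁺ (∈-allFin x) (∈-allFin y)
              , [ (λ b → b) , (λ ()) ∘ proj₁ ]′ (del x∈s y∈s x<y eq))

    -- With no pass left, a collision would have depth at least `k`, against `depth<`.
    delayed⇒distinct : ∀ {k c} → length s ≤ k → Witnessed c → Delayed k 0 [] c →
      ∀ {x y} → x ∈ s → y ∈ s → x Fin.< y → c x ≢ c y
    delayed⇒distinct s≤k W del x∈s y∈s x<y eq with del x∈s y∈s x<y eq
    ... | inj₁ b = ℕ.<⇒≱ (depth< W x∈s) (ℕ.≤-trans s≤k (subst (_ ≤_) (ℕ.+-identityʳ _) b))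

    delayed⇒injective : ∀ {k c} → length s ≤ k → Witnessed c → Delayed k 0 [] c → InjectiveOn s c
    delayed⇒injective {k} {c} s≤k W del {x} {y} x∈s y∈s eq with Fin.<-cmp x y
    ... | tri< x<y _ _ = contradiction eq (delayed⇒distinct s≤k W del x∈s y∈s x<y)
    ... | tri≈ _ x≡y _ = x≡y
    ... | tri> _ _ y<x = contradiction (sym eq) (delayed⇒distinct s≤k W del y∈s x∈s y<x)

-- The number of nodes of the full binary tree of depth `k`; `code` numbers them, and is faithful
-- only up to that depth.
treeSize : ℕ → ℕ
treeSize zero    = 1
treeSize (suc k) = suc (2 * treeSize k)

k≤treeSize : ∀ k → k ≤ treeSize k
k≤treeSize zero    = z≤n
k≤treeSize (suc k) = s≤s (ℕ.≤-trans (k≤treeSize k) (ℕ.m≤m+n _ _))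

code : ∀ k → Node → Fin (treeSize k)
code zero    _       = zero
code (suc k) []      = zero
code (suc k) (d ∷ h) = suc (combine d (code k h))

code-injective : ∀ k {h w} → length h ≤ k → length w ≤ k → code k h ≡ code k w → h ≡ w
code-injective zero    {[]}    {[]}    _ _ _ = refl
code-injective (suc k) {[]}    {[]}    _ _ _ = refl
code-injective (suc k) {d ∷ h} {e ∷ w} (s≤s h≤k) (s≤s w≤k) eq
  with d≡e , eq′ ← Fin.combine-injective d (code k h) e (code k w) (Fin.suc-injective eq) =
  cong₂ _∷_ d≡e (code-injective k h≤k w≤k eq′)

module _ {m : ℕ} {H : Set} (M : Malcev H) (k : ℕ) where

  average : ((Fin m → Fin (treeSize k)) → H) → H
  average φ = passes M k (λ c → φ (code k ∘ c)) (λ _ → [])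

  -- `average` does not mention `s`, so functions with different supports are averaged by one
  -- formula, and a relation among them can be analysed on any common small `s`.
  average-closed : ∀ {s} → length s ≤ k → {I : Set} {Λ : (I → H) → Set} → Closed M Λ →
    ∀ {ψ : I → (Fin m → Fin (treeSize k)) → H} → (∀ i → DependsOn s (ψ i)) →
    (∀ {c} → InjectiveOn s c → Λ (λ i → ψ i c)) →
    Λ (λ i → average (ψ i))
  average-closed {s} s≤k cl {ψ} loc good =
    passes-closed s k M cl {ψ = λ i c → ψ i (code k ∘ c)}
      (λ i c≈ → loc i (λ x∈s → cong (code k) (c≈ x∈s)))
      (λ {c} W del → good λ {x} {y} x∈s y∈s eq →
        delayed⇒injective s s≤k W del x∈s y∈s (code-injective k (shallow W x∈s) (shallow W y∈s) eq))
      -- At the root no proper subtree has been entered, and all `k` passes remain to make up for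
      -- depth 0.
      k (λ _ _ _ ()) (λ _ _ _ _ → inj₁ ℕ.≤-refl)
    where
    shallow : ∀ {c} → Witnessed s c → ∀ {x} → x ∈ s → length (c x) ≤ k
    shallow W x∈s = ℕ.≤-trans (ℕ.<⇒≤ (depth< s W x∈s)) s≤k

-- The pigeonhole graph

funToFin-cong : {f g : Fin m → Fin n} → f ≗ g → funToFin f ≡ funToFin g
funToFin-cong {zero}  _   = refl
funToFin-cong {suc m} f≗g = cong₂ combine (f≗g zero) (funToFin-cong (f≗g ∘ suc))

K₃-finite : IsFinite K₃
K₃-finite = record
  { dom-finite = λ _ → 3 , ↔-id (Fin 3)
  ; rel?       = λ { _ (x ∷ y ∷ []) → ¬? (x Fin.≟ y) } }

third-colour : ∀ {a b c x : Fin 3} → a ≢ b → a ≢ c → b ≢ c → x ≢ a → x ≢ b → x ≡ c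
third-colour {a} {b} {c} {x} = toWitness
  {a? = Fin.all? λ a → Fin.all? λ b → Fin.all? λ c → Fin.all? λ x →
    ¬? (a Fin.≟ b) →-dec ¬? (a Fin.≟ c) →-dec ¬? (b Fin.≟ c) →-dec
    ¬? (x Fin.≟ a) →-dec ¬? (x Fin.≟ b) →-dec (x Fin.≟ c)} _ a b c x

module PigeonholeGraph (P N : ℕ) where

  Vertex : Set
  Vertex = Fin P × Fin P × Fin (3 ^ (N * N))

  scope : Vertex → List (Fin P)
  scope (i , j , _) = i ∷ j ∷ []

  eval : (Fin P → Fin N) → Vertex → Fin 3
  eval f (i , j , e) = finToFun e (combine (f i) (f j))

  -- Placements are quantified through their codes, which keeps the edge relation decidable;
  -- `adjacent⇒≢` recovers arbitrary placements.
  Adjacent : Vertex → Vertex → Set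
  Adjacent v w = ∀ k → let f = finToFun k in
    InjectiveOn (scope v ++ scope w) f → eval f v ≢ eval f w

  graph : Structure graphVocabulary
  graph = record
    { Dom = λ _ → Vertex
    ; Rel = λ { _ (v ∷ w ∷ []) → Adjacent v w } }

  graph-finite : IsFinite graph
  graph-finite = record
    { dom-finite = λ _ → _ , (↔-sym Fin.*↔× ↔-∘ (↔-id _ ×-↔ ↔-sym Fin.*↔×))
    ; rel?       = λ { _ (v ∷ w ∷ []) → Fin.all? λ k →
        injectiveOn? (scope v ++ scope w) (finToFun k) →-dec
        ¬? (eval (finToFun k) v Fin.≟ eval (finToFun k) w) } }

  eval-dependsOn : ∀ v {f g} → f ≈[ scope v ] g → eval f v ≡ eval g v
  eval-dependsOn (i , j , e) f≈g =
    cong₂ (λ u w → finToFun e (combine u w)) (f≈g (here refl)) (f≈g (there (here refl)))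

  adjacent⇒≢ : ∀ {v w} → Adjacent v w → ∀ {f} → InjectiveOn (scope v ++ scope w) f → eval f v ≢ eval f w
  adjacent⇒≢ {v} {w} adj {f} f-inj eq = adj (funToFin f) (injectiveOn-resp (λ {i} _ → sym (f′ i)) f-inj)
    (trans (eval-dependsOn v (λ {i} _ → f′ i)) (trans eq (sym (eval-dependsOn w (λ {i} _ → f′ i)))))
    where
    f′ : finToFun (funToFin f) ≗ f
    f′ = Fin.finToFun-funToFin f

  -- A function of one hole: the pigeon is named twice, and `quotient` reads off the first hole of
  -- the pair.
  vertex : Fin P → (Fin N → Fin 3) → Vertex
  vertex i e = i , i , funToFin (e ∘ quotient N)

  eval-vertex : ∀ i e f → eval f (vertex i e) ≡ e (f i)
  eval-vertex i e f = trans (Fin.finToFun-funToFin (e ∘ quotient N) (combine (f i) (f i)))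
    (cong e (cong proj₁ (Fin.remQuot-combine (f i) (f i))))

  vertex-cong : ∀ i {e e′} → e ≗ e′ → vertex i e ≡ vertex i e′
  vertex-cong i e≗e′ = cong (λ k → i , i , k) (funToFin-cong (e≗e′ ∘ quotient N))

  -- Below, at, and above t; a colouring of graph restricts to a colouring of K₃³ by these functions.
  by-position : ℕ → Fin 3 → Fin 3 → Fin 3 → Fin N → Fin 3
  by-position t a b c u = if toℕ u <ᵇ t then a else if toℕ u <ᵇ suc t then b else c

  module _ (colouring : Hom graph K₃) where
    open Hom colouring

    colour : Fin P → (Fin N → Fin 3) → Fin 3
    colour i e = fun (vertex i e)

    -- The two implications are what an injective placement guarantees about the holes `u` of `i`
    -- and `w` of `j`.
    colour-≢ : ∀ {i j e e′} → (∀ u w → (i ≡ j → u ≡ w) → (u ≡ w → i ≡ j) → e u ≢ e′ w) →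
               colour i e ≢ colour j e′
    colour-≢ {i} {j} {e} {e′} differ = preserve tt (vertex i e ∷ vertex j e′ ∷ []) λ k f-inj eq →
      let f = finToFun k in
      differ (f i) (f j) (cong f) (f-inj (here refl) (there (there (here refl))))
        (trans (sym (eval-vertex i e f)) (trans eq (eval-vertex j e′ f)))

    base : Fin P → Fin 3 → Fin 3
    base i a = colour i (const a)

    base-≢ : ∀ {i j a b} → a ≢ b → base i a ≢ base j b
    base-≢ a≢b = colour-≢ λ _ _ _ _ → a≢b

    -- The constants 0 and 2 at `j` rule out the same two colours for both sides. This makes the
    -- colours of different pigeons comparable.
    base-const : ∀ i j → base i 1F ≡ base j 1F
    base-const i j = third-colour {base j 0F} {base j 2F}
      (base-≢ λ ()) (base-≢ λ ()) (base-≢ λ ()) (base-≢ λ ()) (base-≢ λ ())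

    module _ (i : Fin P) where

      step-colour : ℕ → Fin 3
      step-colour t = colour i (by-position t 1F 0F 0F)

      step-colour-0 : step-colour 0 ≡ base i 0F
      step-colour-0 = cong fun (vertex-cong i eq)
        where
        eq : by-position 0 1F 0F 0F ≗ const 0F
        eq u with toℕ u <ᵇ 1
        ... | true  = refl
        ... | false = refl

      step-colour-N : step-colour N ≡ base i 1F
      step-colour-N = cong fun (vertex-cong i eq)
        where
        eq : by-position N 1F 0F 0F ≗ const 1F
        eq u with toℕ u <ᵇ N in lt
        ... | true  = refl
        ... | false = contradiction (subst T lt (ℕ.<⇒<ᵇ (Fin.toℕ<n u))) λ ()

      step-colour-≢2 : ∀ t → step-colour t ≢ base i 2F
      step-colour-≢2 t = colour-≢ λ u _ _ _ → differ u
        where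
        differ : ∀ u → by-position t 1F 0F 0F u ≢ 2F
        differ u with toℕ u <ᵇ t | toℕ u <ᵇ suc t
        ... | true  | _     = λ ()
        ... | false | true  = λ ()
        ... | false | false = λ ()

      -- A discrete intermediate value argument: raising the threshold leads from the constant 0 to
      -- the constant 1 and always avoids the colour of the constant 2. At the jump, changing the
      -- value at hole `t` alone changes the colour.
      jump : ∀ n → step-colour n ≡ base i 1F →
             ∃[ t ] t < n × step-colour t ≡ base i 0F × step-colour (suc t) ≡ base i 1F
      jump zero    eq = contradiction (trans (sym step-colour-0) eq) (base-≢ λ ())
      jump (suc n) eq with step-colour n Fin.≟ base i 1F
      ... | yes eq′ = let t , t<n , p = jump n eq′ in t , ℕ.m≤n⇒m≤1+n t<n , p
      ... | no ne   = n , ℕ.≤-refl , third-colour {base i 1F} {base i 2F}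
              (base-≢ λ ()) (base-≢ λ ()) (base-≢ λ ()) ne (step-colour-≢2 n) , eq

      module _ (t : ℕ) (at-t : step-colour t ≡ base i 0F) (at-1+t : step-colour (suc t) ≡ base i 1F) where

        private
          κ : Fin 3 → Fin 3 → Fin 3 → Fin 3
          κ a b c = colour i (by-position t a b c)

          κ-≢ : ∀ {a b c a′ b′ c′} → a ≢ a′ → b ≢ b′ → c ≢ c′ → κ a b c ≢ κ a′ b′ c′
          κ-≢ {a} {b} {c} {a′} {b′} {c′} a≢ b≢ c≢ = colour-≢ λ { u _ same _ → differ u (same refl) }
            where
            differ : ∀ u {w} → u ≡ w → by-position t a b c u ≢ by-position t a′ b′ c′ w
            differ u refl with toℕ u <ᵇ t | toℕ u <ᵇ suc t
            ... | true  | _     = a≢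
            ... | false | true  = b≢
            ... | false | false = c≢

          κ-≢-base : ∀ {a b c d} → a ≢ d → b ≢ d → c ≢ d → κ a b c ≢ base i d
          κ-≢-base {a} {b} {c} {d} a≢ b≢ c≢ = colour-≢ λ u _ _ _ → differ u
            where
            differ : ∀ u → by-position t a b c u ≢ d
            differ u with toℕ u <ᵇ t | toℕ u <ᵇ suc t
            ... | true  | _     = a≢
            ... | false | true  = b≢
            ... | false | false = c≢

          κ110 : κ 1F 1F 0F ≡ base i 1F
          κ110 = trans (cong fun (vertex-cong i eq)) at-1+t
            where
            eq : by-position t 1F 1F 0F ≗ by-position (suc t) 1F 0F 0F
            eq u with toℕ u <ᵇ t in lt | toℕ u <ᵇ suc t in lt′
            ... | true  | true  = refl
            ... | false | true  = refl
            ... | true  | false = contradiction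
                  (subst T lt′ (ℕ.<⇒<ᵇ (ℕ.m≤n⇒m≤1+n (ℕ.<ᵇ⇒< (toℕ u) t (subst T (sym lt) tt))))) λ ()
            ... | false | false with toℕ u <ᵇ suc (suc t)
            ... | true  = refl
            ... | false = refl

          distinct : ∀ {a b} → a ≢ b → base i a ≢ base i b
          distinct = base-≢

        -- The constant 2 excludes its own colour. If this were the colour of the constant 0, then
        -- `κ 0F 2F 1F` and `κ 2F 0F 2F` would avoid that colour, by adjacency to (1,0,0) and
        -- (0,1,0), and would differ from each other; their common neighbour (1,1,0) would be forced
        -- to take it, against `κ110`.
        κ010 : κ 0F 1F 0F ≡ base i 1F
        κ010 with κ 0F 1F 0F Fin.≟ base i 0F
        ... | no ne  = third-colour {base i 0F} {base i 2F}
              (distinct λ ()) (distinct λ ()) (distinct λ ()) ne (κ-≢-base (λ ()) (λ ()) (λ ()))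
        ... | yes eq = contradiction (trans (sym κ110) o≡) (distinct λ ())
          where
          p≢ : κ 0F 2F 1F ≢ base i 0F
          p≢ e = κ-≢ {0F} {2F} {1F} {1F} {0F} {0F} (λ ()) (λ ()) (λ ()) (trans e (sym at-t))
          q≢ : κ 2F 0F 2F ≢ base i 0F
          q≢ e = κ-≢ {2F} {0F} {2F} {0F} {1F} {0F} (λ ()) (λ ()) (λ ()) (trans e (sym eq))
          o≡ : κ 1F 1F 0F ≡ base i 0F
          o≡ = third-colour {κ 0F 2F 1F} {κ 2F 0F 2F}
            (κ-≢ (λ ()) (λ ()) (λ ())) p≢ q≢ (κ-≢ (λ ()) (λ ()) (λ ())) (κ-≢ (λ ()) (λ ()) (λ ()))

        -- The triples (1,0,1), (0,2,0) and (2,1,2) get the colours of 0, 2 and 1 in turn: each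
        -- excludes one colour by adjacency to its predecessor, starting from (0,1,0), and another
        -- by the constant whose value it omits.
        κ212 : κ 2F 1F 2F ≡ base i 1F
        κ212 = third-colour {base i 0F} {base i 2F} (distinct λ ()) (distinct λ ()) (distinct λ ())
          (κ-≢-base (λ ()) (λ ()) (λ ()))
          (λ eq → κ-≢ {2F} {1F} {2F} {0F} {2F} {0F} (λ ()) (λ ()) (λ ()) (trans eq (sym κ020)))
          where
          κ101 : κ 1F 0F 1F ≡ base i 0F
          κ101 = third-colour {base i 1F} {base i 2F} (distinct λ ()) (distinct λ ()) (distinct λ ())
            (λ eq → κ-≢ {1F} {0F} {1F} {0F} {1F} {0F} (λ ()) (λ ()) (λ ()) (trans eq (sym κ010)))
            (κ-≢-base (λ ()) (λ ()) (λ ()))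
          κ020 : κ 0F 2F 0F ≡ base i 2F
          κ020 = third-colour {base i 0F} {base i 1F} (distinct λ ()) (distinct λ ()) (distinct λ ())
            (λ eq → κ-≢ {0F} {2F} {0F} {1F} {0F} {1F} (λ ()) (λ ()) (λ ()) (trans eq (sym κ101)))
            (κ-≢-base (λ ()) (λ ()) (λ ()))

    selects : ∀ i → ∃[ t ] t < N × colour i (by-position t 0F 1F 0F) ≡ base i 1F
                                 × colour i (by-position t 2F 1F 2F) ≡ base i 1F
    selects i = let t , t<N , at-t , at-1+t = jump i N (step-colour-N i) in
      t , t<N , κ010 i t at-t at-1+t , κ212 i t at-t at-1+t

    hole : Fin P → Fin N
    hole i = fromℕ< (proj₁ (proj₂ (selects i)))

    -- At a common hole `t`, the functions 0,1,0 of `i` and 2,1,2 of `j` have the same colour. But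
    -- they agree only when both pigeons sit in `t`, which no injective placement allows, so they
    -- are adjacent.
    hole-injective : ∀ {i j} → i ≢ j → hole i ≢ hole j
    hole-injective {i} {j} i≢j eq =
      let t , _ , κ010ᵢ , _     = selects i
          _ , _ , _     , κ212ⱼ = selects j
      in disjoint t (trans κ010ᵢ (trans (base-const i j) (trans (sym κ212ⱼ)
           (cong (λ t → colour j (by-position t 2F 1F 2F)) (sym (Fin.fromℕ<-injective _ _ _ _ eq))))))
      where
      middle : ∀ {t} {u : Fin N} → (toℕ u <ᵇ t) ≡ false → (toℕ u <ᵇ suc t) ≡ true → toℕ u ≡ t
      middle {t} {u} ge lt = ℕ.≤-antisym (s≤s⁻¹ (ℕ.<ᵇ⇒< (toℕ u) (suc t) (subst T (sym lt) tt)))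
        (ℕ.≮⇒≥ λ u<t → subst T ge (ℕ.<⇒<ᵇ u<t))
      disjoint : ∀ t → colour i (by-position t 0F 1F 0F) ≢ colour j (by-position t 2F 1F 2F)
      disjoint t = colour-≢ λ u w _ same → differ u w (i≢j ∘ same)
        where
        differ : ∀ u w → u ≢ w → by-position t 0F 1F 0F u ≢ by-position t 2F 1F 2F w
        differ u w u≢w with toℕ u <ᵇ t in u≥ | toℕ u <ᵇ suc t in u≤ | toℕ w <ᵇ t in w≥ | toℕ w <ᵇ suc t in w≤
        ... | false | true  | false | true  = contradiction
              (Fin.toℕ-injective (trans (middle u≥ u≤) (sym (middle w≥ w≤)))) u≢w
        ... | true  | _     | true  | _     = λ ()
        ... | true  | _     | false | true  = λ ()
        ... | true  | _     | false | false = λ ()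
        ... | false | false | true  | _     = λ ()
        ... | false | false | false | true  = λ ()
        ... | false | false | false | false = λ ()
        ... | false | true  | true  | _     = λ ()
        ... | false | true  | false | false = λ ()

  uncolourable : N < P → ¬ Hom graph K₃
  uncolourable N<P colouring =
    let i , j , i<j , eq = Fin.pigeonhole N<P (hole colouring)
    in hole-injective colouring (Fin.<⇒≢ i<j) eq

-- Datalog on the pigeonhole graph

-- The factor 2 counts the two pigeons of each vertex.
RuleFits : ∀ {S} {σ : Vocabulary S} {idbs} → ℕ → Rule σ idbs → Set
RuleFits n r = length (vars r) * 2 + length (arity₀ r) * 2 ≤ n

Fits : ∀ {S} {σ : Vocabulary S} {out} → ℕ → Program σ out → Set
Fits n p = All (RuleFits n) (rules p)

module DatalogTransfer (P N : ℕ) where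
  open PigeonholeGraph P N

  scopes : ∀ {us : List ⊤} → All (λ _ → Vertex) us → List (Fin P)
  scopes []       = []
  scopes (v ∷ vs) = scope v ++ scopes vs

  length-scopes : ∀ {us} (vs : All (λ _ → Vertex) us) → length (scopes vs) ≡ length us * 2
  length-scopes []       = refl
  length-scopes (v ∷ vs) = cong (2 +_) (length-scopes vs)

  evalAll : ∀ {us : List ⊤} → (Fin P → Fin N) → All (λ _ → Vertex) us → All (λ _ → Fin 3) us
  evalAll f = All.map (eval f)

  evalAll-dependsOn : ∀ {us} (vs : All (λ _ → Vertex) us) {f g} →
                      f ≈[ scopes vs ] g → evalAll f vs ≡ evalAll g vs
  evalAll-dependsOn []       _   = refl
  evalAll-dependsOn (v ∷ vs) f≈g =
    cong₂ _∷_ (eval-dependsOn v (f≈g ∘ ∈-++⁺ˡ)) (evalAll-dependsOn vs (f≈g ∘ ∈-++⁺ʳ (scope v)))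

  scope-lookup : ∀ {us u} (ν : All (λ _ → Vertex) us) (x : u ∈ us) → scope (All.lookup ν x) ⊆ scopes ν
  scope-lookup (v ∷ ν) (here refl) = ∈-++⁺ˡ
  scope-lookup (v ∷ ν) (there x)   = ∈-++⁺ʳ (scope v) ∘ scope-lookup ν x

  scopes-instantiate : ∀ {vs us} (ν : All (λ _ → Vertex) vs) (xs : All (_∈ vs) us) →
                       scopes (instantiate graph ν xs) ⊆ scopes ν
  scopes-instantiate ν (x ∷ xs) p with ∈-++⁻ (scope (All.lookup ν x)) p
  ... | inj₁ q = scope-lookup ν x q
  ... | inj₂ q = scopes-instantiate ν xs q

  instantiate-evalAll : ∀ {vs us} g (ν : All (λ _ → Vertex) vs) (xs : All (_∈ vs) us) →
                        instantiate K₃ (evalAll g ν) xs ≡ evalAll g (instantiate graph ν xs)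
  instantiate-evalAll g ν []       = refl
  instantiate-evalAll g ν (x ∷ xs) = cong₂ _∷_ (lookup-map ν x) (instantiate-evalAll g ν xs)

  module _ {idbs : List (List ⊤)} {rs : List (Rule graphVocabulary idbs)} (fits : All (RuleFits N) rs) where

    -- There need be no placement injective on the whole derivation. At each rule only the pigeons
    -- of the head are held fixed, and the remaining variables get a new placement by `extend`.
    derivable-eval : ∀ {us} {Q : us ∈ idbs} {x} → Derivable graph rs Q x →
                     ∀ {f} → InjectiveOn (scopes x) f → Derivable K₃ rs Q (evalAll f x)
    satisfied-eval : ∀ {vs} {ν : All (λ _ → Vertex) vs} {as} → All (Satisfied graph rs ν) as →
                     ∀ {g} → InjectiveOn (scopes ν) g → All (Satisfied K₃ rs (evalAll g ν)) as

    derivable-eval (apply {r} r∈rs ν body) {f} f-inj =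
      let x = instantiate graph ν (head-args r)
          bound = ℕ.≤-trans (ℕ.≤-reflexive (cong₂ _+_ (length-scopes ν) (length-scopes x)))
                    (All.lookup fits r∈rs)
          g , g≈f , g-inj = extend (scopes x) (scopes ν) f bound f-inj
      in subst (Derivable K₃ rs (head r))
           (trans (instantiate-evalAll g ν (head-args r)) (evalAll-dependsOn x g≈f))
           (apply r∈rs (evalAll g ν) (satisfied-eval body (λ i∈ j∈ → g-inj (∈-++⁺ˡ i∈) (∈-++⁺ˡ j∈))))

    satisfied-eval [] _ = []
    satisfied-eval {ν = ν} (edb {xs = x ∷ y ∷ []} adj ∷ body) {g} g-inj =
      edb (λ eq → adjacent⇒≢ {All.lookup ν x} {All.lookup ν y} adj
            (λ i∈ j∈ → g-inj (sub i∈) (sub j∈))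
            (trans (sym (lookup-map ν x)) (trans eq (lookup-map ν y))))
      ∷ satisfied-eval body g-inj
      where
      sub : scope (All.lookup ν x) ++ scope (All.lookup ν y) ⊆ scopes ν
      sub p with ∈-++⁻ (scope (All.lookup ν x)) p
      ... | inj₁ q = scope-lookup ν x q
      ... | inj₂ q = scope-lookup ν y q
    satisfied-eval {ν = ν} (idb {xs = xs} der ∷ body) {g} g-inj =
      idb (subst (Derivable K₃ rs _) (sym (instantiate-evalAll g ν xs))
            (derivable-eval der λ i∈ j∈ → g-inj (scopes-instantiate ν xs i∈) (scopes-instantiate ν xs j∈)))
      ∷ satisfied-eval body g-inj

-- The two halves of the or-construction

module _ (G : Group 0ℓ 0ℓ) where
  open Group G
  open SetoidReasoning setoid

  heap-translate : ∀ x y z g → (x ∙ g) ∙ ((y ∙ g) ⁻¹ ∙ (z ∙ g)) ≈ (x ∙ (y ⁻¹ ∙ z)) ∙ g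
  heap-translate x y z g = begin
    (x ∙ g) ∙ ((y ∙ g) ⁻¹ ∙ (z ∙ g))        ≈⟨ ∙-congˡ (∙-congʳ (⁻¹-anti-homo-∙ y g)) ⟩
    (x ∙ g) ∙ ((g ⁻¹ ∙ y ⁻¹) ∙ (z ∙ g))     ≈⟨ ∙-congˡ (assoc _ _ _) ⟩
    (x ∙ g) ∙ (g ⁻¹ ∙ (y ⁻¹ ∙ (z ∙ g)))     ≈⟨ assoc _ _ _ ⟩
    x ∙ (g ∙ (g ⁻¹ ∙ (y ⁻¹ ∙ (z ∙ g))))     ≈⟨ ∙-congˡ (\\-leftDividesˡ g _) ⟩
    x ∙ (y ⁻¹ ∙ (z ∙ g))                    ≈⟨ ∙-congˡ (assoc _ _ _) ⟨
    x ∙ ((y ⁻¹ ∙ z) ∙ g)                    ≈⟨ assoc _ _ _ ⟨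
    (x ∙ (y ⁻¹ ∙ z)) ∙ g                    ∎
    where open GroupProperties G

module _ (Γ : FiniteGroup) where
  open FiniteGroup Γ

  heap : Fin order → Fin order → Fin order → Fin order
  heap x y z = x ∙ ((y ⁻¹) ∙ z)

module _ (Γ : FiniteGroup) (r : ℕ) where
  open FiniteGroup Γ

  ⟦⟧-cong : ∀ {X x y} → x ≗ y → ⟦_⟧ Γ r X x → ⟦_⟧ Γ r X y
  ⟦⟧-cong {X} x≗y = subst (_∈ˢ X) (funToFin-cong x≗y)

  -- Writing the three elements as γδ, the inner factors δ cancel and the last one remains, by
  -- `heap-translate`.
  coset-heap : ∀ {X} → IsRightCoset Γ r X → ∀ x y z → ⟦_⟧ Γ r X x → ⟦_⟧ Γ r X y → ⟦_⟧ Γ r X z →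
               ⟦_⟧ Γ r X (λ i → heap Γ (x i) (y i) (z i))
  coset-heap (Δ , Δ≤ , δ , X⇔) x y z x∈ y∈ z∈ =
    let γ₁ , γ₁∈ , x≈ = Equivalence.to (X⇔ x) x∈
        γ₂ , γ₂∈ , y≈ = Equivalence.to (X⇔ y) y∈
        γ₃ , γ₃∈ , z≈ = Equivalence.to (X⇔ z) z∈
        open Group (power Γ r) using () renaming (_∙_ to _·_; _⁻¹ to inv)
        open IsSubgroup Δ≤
    in Equivalence.from (X⇔ _)
      ( γ₁ · (inv γ₂ · γ₃) , ∙-closed γ₁∈ (∙-closed (⁻¹-closed γ₂∈) γ₃∈)
      , λ i → trans (cong₂ _∙_ (x≈ i) (cong₂ _∙_ (cong _⁻¹ (y≈ i)) (z≈ i)))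
                (heap-translate group (γ₁ i) (γ₂ i) (γ₃ i) (δ i)))

-- By `half-side`, the side of any one coordinate determines the half in which the whole tuple lies.
record Halves {H : Set} (M : Malcev H) (side : H → Bool) {n : ℕ} (Q : (Fin n → H) → Set) : Set₁ where
  field
    half        : Bool → (Fin n → H) → Set
    half-closed : ∀ b → Closed M (half b)
    split       : ∀ {u} → Q u → ∃[ b ] half b u
    join        : ∀ {b u} → half b u → Q u
    half-side   : ∀ {b u} → half b u → ∀ i → side (u i) ≡ b

module OrMalcev (Γ₁ Γ₂ : FiniteGroup) where
  private
    module Γ₁ = FiniteGroup Γ₁
    module Γ₂ = FiniteGroup Γ₂
    A₁ = Γ₁ ^[ 3 ]
    A₂ = Γ₂ ^[ 3 ]

  D : Set
  D = OrDom (Fin Γ₁.order) (Fin Γ₂.order)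

  infix 4 _≟ᴰ_
  _≟ᴰ_ : (x y : D) → Dec (x ≡ y)
  x ≟ᴰ y = map′ (encode-injective x y) (cong encode)
    (Sum.≡-dec (Sum.≡-dec Fin._≟_ Fin._≟_) Fin._≟_ (encode x) (encode y))
    where
    encode : D → (Fin Γ₁.order ⊎ Fin Γ₂.order) ⊎ Fin 2
    encode (in₁ a) = inj₁ (inj₁ a)
    encode (in₂ a) = inj₁ (inj₂ a)
    encode c₁      = inj₂ 0F
    encode c₂      = inj₂ 1F
    encode-injective : ∀ x y → encode x ≡ encode y → x ≡ y
    encode-injective (in₁ a) (in₁ .a) refl = refl
    encode-injective (in₂ a) (in₂ .a) refl = refl
    encode-injective c₁      c₁       _    = refl
    encode-injective c₂      c₂       _    = refl

  heapᴰ : D → D → D → D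
  heapᴰ (in₁ x) (in₁ y) (in₁ z) = in₁ (heap Γ₁ x y z)
  heapᴰ (in₂ x) (in₂ y) (in₂ z) = in₂ (heap Γ₂ x y z)
  heapᴰ x       _       _       = x

  -- The Mal'cev identities are imposed by cases, since averaging relies on them for all arguments;
  -- `op-in₁` and `op-in₂` show that this leaves the group operations intact.
  opᴰ : D → D → D → D
  opᴰ x y z with y ≟ᴰ z | x ≟ᴰ y
  ... | yes _ | _     = x
  ... | no _  | yes _ = z
  ... | no _  | no _  = heapᴰ x y z

  malcev : Malcev D
  malcev = record { op = opᴰ ; xyy≡x = xyy ; yyz≡z = yyz }
    where
    xyy : ∀ x y → opᴰ x y y ≡ x
    xyy x y with y ≟ᴰ y | x ≟ᴰ y
    ... | yes _ | _ = refl
    ... | no ne | _ = contradiction refl ne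
    yyz : ∀ y z → opᴰ y y z ≡ z
    yyz y z with y ≟ᴰ z | y ≟ᴰ y
    ... | yes y≡z | _     = y≡z
    ... | no _    | yes _ = refl
    ... | no _    | no ne = contradiction refl ne

  op-in₁ : ∀ x y z → opᴰ (in₁ x) (in₁ y) (in₁ z) ≡ in₁ (heap Γ₁ x y z)
  op-in₁ x y z with in₁ y ≟ᴰ in₁ z | in₁ x ≟ᴰ in₁ y
  ... | yes refl | _        = cong in₁ (sym (trans (cong (x Γ₁.∙_) (Group.inverseˡ Γ₁.group y))
                                               (Group.identityʳ Γ₁.group x)))
  ... | no _     | yes refl = cong in₁ (sym (GroupProperties.\\-leftDividesˡ Γ₁.group x z))
  ... | no _     | no _     = refl

  op-in₂ : ∀ x y z → opᴰ (in₂ x) (in₂ y) (in₂ z) ≡ in₂ (heap Γ₂ x y z)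
  op-in₂ x y z with in₂ y ≟ᴰ in₂ z | in₂ x ≟ᴰ in₂ y
  ... | yes refl | _        = cong in₂ (sym (trans (cong (x Γ₂.∙_) (Group.inverseˡ Γ₂.group y))
                                               (Group.identityʳ Γ₂.group x)))
  ... | no _     | yes refl = cong in₂ (sym (GroupProperties.\\-leftDividesˡ Γ₂.group x z))
  ... | no _     | no _     = refl

  -- Each constant joins the opposite structure, so that both kinds of pairs in `S` are one-sided.
  side : D → Bool
  side (in₁ _) = true
  side (in₂ _) = false
  side c₁      = false
  side c₂      = true

  Point : D → {n : ℕ} → (Fin n → D) → Set
  Point c u = ∀ i → u i ≡ c

  op-cong : ∀ {x x′ y y′ z z′} → x ≡ x′ → y ≡ y′ → z ≡ z′ → opᴰ x y z ≡ opᴰ x′ y′ z′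
  op-cong refl refl refl = refl

  point-closed : ∀ c {n} → Closed malcev (Point c {n})
  point-closed c = record
    { resp   = λ u≗v p i → trans (sym (u≗v i)) (p i)
    ; closed = λ p q r i → trans (op-cong (p i) (q i) (r i)) (Malcev.xyy≡x malcev c c) }

  module _ {Γ : FiniteGroup} (emb : Fin (FiniteGroup.order Γ) → D) where

    InCoset : Symbol (cosetVocabulary Γ 3) → (Fin 3 → D) → Set
    InCoset X u = ∃[ v ] (∀ i → u i ≡ emb (v i)) × ⟦_⟧ Γ 3 (value X) v

    coset-closed : (∀ x y z → opᴰ (emb x) (emb y) (emb z) ≡ emb (heap Γ x y z)) →
                   ∀ X → Closed malcev (InCoset X)
    coset-closed op-emb X = record
      { resp   = λ { u≗v (w , e , w∈) → w , (λ i → trans (sym (u≗v i)) (e i)) , w∈ }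
      ; closed = λ { {u} {v} {w} (u′ , eu , u∈) (v′ , ev , v∈) (w′ , ew , w∈) →
          (λ i → heap Γ (u′ i) (v′ i) (w′ i))
        , (λ i → trans (op-cong (eu i) (ev i) (ew i)) (op-emb (u′ i) (v′ i) (w′ i)))
        , in-coset X u′ v′ w′ u∈ v∈ w∈ } }
      where
      in-coset : ∀ (X : Symbol (cosetVocabulary Γ 3)) x y z →
             ⟦_⟧ Γ 3 (value X) x → ⟦_⟧ Γ 3 (value X) y → ⟦_⟧ Γ 3 (value X) z →
             ⟦_⟧ Γ 3 (value X) (λ i → heap Γ (x i) (y i) (z i))
      in-coset (X Refinement., [ X-coset ]) x y z x∈ y∈ z∈ =
        -- The coset property is stored irrelevantly, but membership in `X` is decidable.
        recompute (_ Subset.∈? X) (coset-heap Γ 3 X-coset x y z x∈ y∈ z∈)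

  triple : (Fin 3 → D) → All (λ _ → D) (tt ∷ tt ∷ tt ∷ [])
  triple u = u 0F ∷ u 1F ∷ u 2F ∷ []

  at : Fin 3 → All (λ _ → D) (tt ∷ tt ∷ tt ∷ []) → D
  at i xs = tabulate⁻ {f = λ _ → tt} xs i

  triple-map⁻ : ∀ {A : Set} (f : A → D) (xs : All (λ _ → A) (tt ∷ tt ∷ tt ∷ [])) u →
                All.map f xs ≡ triple u →
                ∀ i → u i ≡ f (tabulate⁻ {f = λ _ → tt} xs i)
  triple-map⁻ f (a ∷ b ∷ c ∷ []) u eq 0F = sym (cong (at 0F) eq)
  triple-map⁻ f (a ∷ b ∷ c ∷ []) u eq 1F = sym (cong (at 1F) eq)
  triple-map⁻ f (a ∷ b ∷ c ∷ []) u eq 2F = sym (cong (at 2F) eq)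

  triple-point⁻ : ∀ {c} u → c ∷ c ∷ c ∷ [] ≡ triple u → Point c u
  triple-point⁻ u eq 0F = sym (cong (at 0F) eq)
  triple-point⁻ u eq 1F = sym (cong (at 1F) eq)
  triple-point⁻ u eq 2F = sym (cong (at 2F) eq)

  triple-cong : ∀ {u v} → u ≗ v → triple u ≡ triple v
  triple-cong u≗v = cong₂ _∷_ (u≗v 0F) (cong₂ _∷_ (u≗v 1F) (cong₂ _∷_ (u≗v 2F) refl))

  tabulate⁻-triple : ∀ {A : Set} (v : Fin 3 → A) →
                     v ≗ tabulate⁻ {P = λ _ → A} {f = λ _ → tt} (v 0F ∷ v 1F ∷ v 2F ∷ [])
  tabulate⁻-triple v 0F = refl
  tabulate⁻-triple v 1F = refl
  tabulate⁻-triple v 2F = refl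

  sym₁-halves : ∀ X → Halves malcev side (OR-Rel A₁ A₂ (sym₁ X) ∘ triple)
  sym₁-halves X = record
    { half        = half
    ; half-closed = λ { true → coset-closed {Γ₁} in₁ op-in₁ X ; false → point-closed c₁ }
    ; split       = λ q → split q refl
    ; join        = λ { {true} → join-coset ; {false} → join-point }
    ; half-side   = λ { {true} (_ , e , _) i → cong side (e i) ; {false} e i → cong side (e i) } }
    where
    half : Bool → (Fin 3 → D) → Set
    half true  = InCoset {Γ₁} in₁ X
    half false = Point c₁
    split : ∀ {u ys} → OR-Rel A₁ A₂ (sym₁ X) ys → ys ≡ triple u → ∃[ b ] half b u
    split {u} (rel₁ {xs = xs} r) eq = true , tabulate⁻ xs , triple-map⁻ in₁ xs u eq , r
    split {u} const₁ eq = false , triple-point⁻ u eq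
    join-coset : ∀ {u} → InCoset {Γ₁} in₁ X u → OR-Rel A₁ A₂ (sym₁ X) (triple u)
    join-coset (v , e , r) = subst (OR-Rel A₁ A₂ (sym₁ X)) (sym (triple-cong e))
      (rel₁ {xs = v 0F ∷ v 1F ∷ v 2F ∷ []} (⟦⟧-cong Γ₁ 3 {value X} (tabulate⁻-triple v) r))
    join-point : ∀ {u} → Point c₁ u → OR-Rel A₁ A₂ (sym₁ X) (triple u)
    join-point e = subst (OR-Rel A₁ A₂ (sym₁ X)) (sym (triple-cong e)) const₁

  sym₂-halves : ∀ X → Halves malcev side (OR-Rel A₁ A₂ (sym₂ X) ∘ triple)
  sym₂-halves X = record
    { half        = half
    ; half-closed = λ { false → coset-closed {Γ₂} in₂ op-in₂ X ; true → point-closed c₂ }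
    ; split       = λ q → split q refl
    ; join        = λ { {false} → join-coset ; {true} → join-point }
    ; half-side   = λ { {false} (_ , e , _) i → cong side (e i) ; {true} e i → cong side (e i) } }
    where
    half : Bool → (Fin 3 → D) → Set
    half false = InCoset {Γ₂} in₂ X
    half true  = Point c₂
    split : ∀ {u ys} → OR-Rel A₁ A₂ (sym₂ X) ys → ys ≡ triple u → ∃[ b ] half b u
    split {u} (rel₂ {xs = xs} r) eq = false , tabulate⁻ xs , triple-map⁻ in₂ xs u eq , r
    split {u} const₂ eq = true , triple-point⁻ u eq
    join-coset : ∀ {u} → InCoset {Γ₂} in₂ X u → OR-Rel A₁ A₂ (sym₂ X) (triple u)
    join-coset (v , e , r) = subst (OR-Rel A₁ A₂ (sym₂ X)) (sym (triple-cong e))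
      (rel₂ {xs = v 0F ∷ v 1F ∷ v 2F ∷ []} (⟦⟧-cong Γ₂ 3 {value X} (tabulate⁻-triple v) r))
    join-point : ∀ {u} → Point c₂ u → OR-Rel A₁ A₂ (sym₂ X) (triple u)
    join-point e = subst (OR-Rel A₁ A₂ (sym₂ X)) (sym (triple-cong e)) const₂

  pair : (Fin 2 → D) → All (λ _ → D) (tt ∷ tt ∷ [])
  pair u = u 0F ∷ u 1F ∷ []

  pair-injective : ∀ {x y} u → x ∷ y ∷ [] ≡ pair u → u 0F ≡ x × u 1F ≡ y
  pair-injective u refl = refl , refl

  symS-halves : Halves malcev side (OR-Rel A₁ A₂ symS ∘ pair)
  symS-halves = record
    { half        = half
    ; half-closed = λ
        { true  → record
          { resp   = λ { u≗v ((a , e) , e′) → (a , trans (sym (u≗v 0F)) e) , trans (sym (u≗v 1F)) e′ }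
          ; closed = λ { ((a , e) , e′) ((b , f) , f′) ((c , g) , g′) →
              (heap Γ₁ a b c , trans (op-cong e f g) (op-in₁ a b c))
              , trans (op-cong e′ f′ g′) (Malcev.xyy≡x malcev c₂ c₂) } }
        ; false → record
          { resp   = λ { u≗v (e′ , (a , e)) → trans (sym (u≗v 0F)) e′ , (a , trans (sym (u≗v 1F)) e) }
          ; closed = λ { (e′ , (a , e)) (f′ , (b , f)) (g′ , (c , g)) →
              trans (op-cong e′ f′ g′) (Malcev.xyy≡x malcev c₁ c₁)
              , (heap Γ₂ a b c , trans (op-cong e f g) (op-in₂ a b c)) } } }
    ; split       = λ q → split q refl
    ; join        = λ
        { {true}  ((_ , e) , e′) → subst (OR-Rel A₁ A₂ symS) (sym (cong₂ (λ x y → x ∷ y ∷ []) e e′)) S-fst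
        ; {false} (e′ , (_ , e)) → subst (OR-Rel A₁ A₂ symS) (sym (cong₂ (λ x y → x ∷ y ∷ []) e′ e)) S-snd }
    ; half-side   = λ { {true} ((_ , e) , e′) → λ { 0F → cong side e ; 1F → cong side e′ }
                      ; {false} (e′ , (_ , e)) → λ { 0F → cong side e′ ; 1F → cong side e } } }
    where
    half : Bool → (Fin 2 → D) → Set
    half true  u = (∃[ a ] u 0F ≡ in₁ a) × u 1F ≡ c₂
    half false u = u 0F ≡ c₁ × (∃[ a ] u 1F ≡ in₂ a)
    split : ∀ {u ys} → OR-Rel A₁ A₂ symS ys → ys ≡ pair u → ∃[ b ] half b u
    split {u} S-fst eq = let e , e′ = pair-injective u eq in true , (_ , e) , e′
    split {u} S-snd eq = let e , e′ = pair-injective u eq in false , e , (_ , e′)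

-- Seeds

first : ∀ {n} → (Fin n → Bool) → Maybe (Fin n)
first {zero}  p = nothing
first {suc n} p = if p zero then just zero else Maybe.map suc (first (p ∘ suc))

first-cong : ∀ {n} {p q : Fin n → Bool} → p ≗ q → first p ≡ first q
first-cong {zero}  p≗q = refl
first-cong {suc n} p≗q rewrite p≗q zero | first-cong (p≗q ∘ suc) = refl

first-found : ∀ {n} (p : Fin n → Bool) i → p i ≡ true → ∃[ j ] first p ≡ just j × p j ≡ true
first-found {suc n} p i pi with p zero in p0
... | true = zero , refl , p0
first-found {suc n} p zero    pi | false = contradiction (trans (sym p0) pi) λ ()
first-found {suc n} p (suc i) pi | false with first-found (p ∘ suc) i pi
... | j , eq , pj rewrite eq = suc j , refl , pj

module Seeds (P k : ℕ) where

  M = treeSize k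
  B = suc k
  N = B * M

  Seed : Set
  Seed = (Fin P → Fin (suc N)) × Fin B

  -- A seed (e , b) fixes the hole u of i if e i = suc u; the other pigeons are placed in block b.
  place : Fin B → Fin (suc N) → Fin M → Fin N
  place b zero    v = combine b v
  place b (suc u) _ = u

  extension : Seed → (Fin P → Fin M) → Fin P → Fin N
  extension (e , b) c i = place b (e i) (c i)

  -- Stated for pairs of pigeons and labels, independently of any element; it makes every extension
  -- of an injective labelling injective.
  Valid : Seed → Set
  Valid (e , b) = ∀ i j v w → place b (e i) v ≡ place b (e j) w → i ≡ j ⊎ v ≡ w

  valid? : ∀ σ → Dec (Valid σ)
  valid? (e , b) = Fin.all? λ i → Fin.all? λ j → Fin.all? λ v → Fin.all? λ w →
    (place b (e i) v Fin.≟ place b (e j) w) →-dec ((i Fin.≟ j) ⊎-dec (v Fin.≟ w))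

  extension-injective : ∀ {σ s c} → Valid σ → InjectiveOn s c → InjectiveOn s (extension σ c)
  extension-injective {c = c} valid c-inj {i} {j} i∈s j∈s eq with valid i j (c i) (c j) eq
  ... | inj₁ i≡j = i≡j
  ... | inj₂ v≡w = c-inj i∈s j∈s v≡w

  extension-cong : ∀ σ {s c c′} → c ≈[ s ] c′ → extension σ c ≈[ s ] extension σ c′
  extension-cong (e , b) c≈ {i} i∈s = cong (place b (e i)) (c≈ i∈s)

  block : Fin N → Fin B
  block = quotient M

  module _ {s : List (Fin P)} {f : Fin P → Fin N} {σ : Seed}
           (fixes : ∀ {i} → i ∈ s → proj₁ σ i ≡ suc (f i)) where

    extension-fixed : ∀ c → extension σ c ≈[ s ] f
    extension-fixed c i∈s rewrite fixes i∈s = refl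

    fixing-valid : (∀ {i} → i ∉ s → proj₁ σ i ≡ zero) → InjectiveOn s f →
                   proj₂ σ ∉ map (block ∘ f) s → Valid σ
    fixing-valid frees f-inj b∉ i j v w with i ∈? s | j ∈? s
    ... | yes i∈s | yes j∈s rewrite fixes i∈s | fixes j∈s = inj₁ ∘ f-inj i∈s j∈s
    ... | yes i∈s | no j∉s  rewrite fixes i∈s | frees j∉s = λ eq → contradiction
            (subst (_∈ map (block ∘ f) s)
              (trans (cong block eq) (cong proj₁ (Fin.remQuot-combine (proj₂ σ) w)))
              (∈-map⁺ (block ∘ f) i∈s)) b∉
    ... | no i∉s  | yes j∈s rewrite frees i∉s | fixes j∈s = λ eq → contradiction
            (subst (_∈ map (block ∘ f) s)
              (trans (cong block (sym eq)) (cong proj₁ (Fin.remQuot-combine (proj₂ σ) v)))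
              (∈-map⁺ (block ∘ f) j∈s)) b∉
    ... | no i∉s  | no j∉s  rewrite frees i∉s | frees j∉s = inj₂ ∘ Fin.combine-injectiveʳ (proj₂ σ) v (proj₂ σ) w

  seedCount : ℕ
  seedCount = suc N ^ P * B

  seed : Fin seedCount → Seed
  seed x = finToFun (proj₁ (remQuot B x)) , proj₂ (remQuot {suc N ^ P} B x)

  -- The at most `k` fixed holes meet at most `k` of the `suc k` blocks, so the other pigeons can be
  -- sent to a block free of fixed holes.
  fixing-seed : ∀ (s : List (Fin P)) f → InjectiveOn s f → length s ≤ k →
                ∃[ x ] Valid (seed x) × (∀ c → extension (seed x) c ≈[ s ] f)
  fixing-seed s f f-inj s≤k
    with fresh (map (block ∘ f) s) (s≤s (ℕ.≤-trans (ℕ.≤-reflexive (length-map (block ∘ f) s)) s≤k))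
  ... | b , b∉ =
    x , fixing-valid fixes frees f-inj (b∉ ∘ subst (_∈ _) (cong proj₂ decode)) , extension-fixed fixes
    where
    e : Fin P → Fin (suc N)
    e i = if does (i ∈? s) then suc (f i) else zero
    x : Fin seedCount
    x = combine (funToFin e) b
    decode : remQuot {suc N ^ P} B x ≡ (funToFin e , b)
    decode = Fin.remQuot-combine (funToFin e) b
    e≗ : proj₁ (seed x) ≗ e
    e≗ i = trans (cong (λ p → finToFun (proj₁ p) i) decode) (Fin.finToFun-funToFin e i)
    e-in : ∀ {i} → i ∈ s → e i ≡ suc (f i)
    e-in {i} i∈s with i ∈? s
    ... | yes _ = refl
    ... | no i∉s = contradiction i∈s i∉s
    e-out : ∀ {i} → i ∉ s → e i ≡ zero
    e-out {i} i∉s with i ∈? s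
    ... | yes i∈s = contradiction i∈s i∉s
    ... | no _ = refl
    fixes : ∀ {i} → i ∈ s → proj₁ (seed x) i ≡ suc (f i)
    fixes {i} i∈s = trans (e≗ i) (e-in i∈s)
    frees : ∀ {i} → i ∉ s → proj₁ (seed x) i ≡ zero
    frees {i} i∉s = trans (e≗ i) (e-out i∉s)

-- Averaging along the first deciding seed

module Averaging (P k₀ : ℕ) {H : Set} (malcev : Malcev H) (side : H → Bool) (default : H) where

  -- Room for the support of one element together with that of a whole related tuple, as
  -- `decides-related` requires.
  k = k₀ + k₀
  open Seeds P k

  record Element : Set where
    field
      support  : List (Fin P)
      small    : length support ≤ k₀
      val      : (Fin P → Fin N) → H
      local    : DependsOn support val

  open Element

  Decides : Seed → Element → Bool → Set
  Decides σ z b = ∀ (x : Fin (M ^ P)) → InjectiveOn (support z) (finToFun x) →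
                  side (val z (extension σ (finToFun x))) ≡ b

  decides : ∀ {σ z b} → Decides σ z b → ∀ {c} → InjectiveOn (support z) c → side (val z (extension σ c)) ≡ b
  decides {σ} {z} dec {c} c-inj = trans
    (cong side (local z (extension-cong σ {c = c} λ {i} _ → sym (c≗ i))))
    (dec (funToFin c) (injectiveOn-resp (λ {i} _ → sym (c≗ i)) c-inj))
    where
    c≗ : finToFun (funToFin c) ≗ c
    c≗ = Fin.finToFun-funToFin c

  Good : Element → Fin seedCount → Set
  Good z x = Valid (seed x) × (Decides (seed x) z true ⊎ Decides (seed x) z false)

  decides? : ∀ σ z b → Dec (Decides σ z b)
  decides? σ z b = Fin.all? λ x → injectiveOn? (support z) (finToFun x) →-dec
    (side (val z (extension σ (finToFun x))) Bool.≟ b)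

  good? : ∀ z x → Dec (Good z x)
  good? z x = valid? (seed x) ×-dec (decides? (seed x) z true ⊎-dec decides? (seed x) z false)

  choose : Element → Maybe (Fin seedCount)
  choose z = first (does ∘ good? z)

  averageOver : Element → Maybe (Fin seedCount) → H
  averageOver z = maybe′ (λ x → average malcev k (val z ∘ extension (seed x))) default

  value-of : Element → H
  value-of z = averageOver z (choose z)

  decided : ∀ z x b → Decides (seed x) z b → Decides (seed x) z true ⊎ Decides (seed x) z false
  decided z x true  d = inj₁ d
  decided z x false d = inj₂ d

  undecided : ∀ z x → Decides (seed x) z true ⊎ Decides (seed x) z false → ∃[ b ] Decides (seed x) z b
  undecided z x (inj₁ d) = true , d
  undecided z x (inj₂ d) = false , d

  k≤M : k₀ + k₀ ≤ M
  k≤M = k≤treeSize k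

  M≤N : M ≤ N
  M≤N = ℕ.m≤m+n M (k * M)

  small-k : ∀ z → length (support z) ≤ k
  small-k z = ℕ.≤-trans (small z) (ℕ.m≤m+n k₀ k₀)

  -- Fixing the entire support makes the value constant. Hence the default in `averageOver` is never
  -- reached by `value-of`.
  some-good : ∀ z → ∃[ x ] Good z x
  some-good z =
    let f , _ , f-inj = extend [] (support z) (λ _ → combine {suc k} zero (code k []))
          (ℕ.≤-trans (ℕ.≤-reflexive (ℕ.+-identityʳ _)) (ℕ.≤-trans (small-k z) (ℕ.≤-trans k≤M M≤N))) (λ ())
        x , valid , fixed =
          fixing-seed (support z) f (λ p q → f-inj (∈-++⁺ˡ p) (∈-++⁺ˡ q)) (small-k z)
    in x , valid , decided z x (side (val z f)) (λ y _ → cong side (local z (fixed (finToFun y))))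

  module _ {n : ℕ} {Q : (Fin (suc n) → H) → Set} (halves : Halves malcev side Q)
           {s : List (Fin P)} (s≤ : length s ≤ k₀) (z : Fin (suc n) → Element)
           (z⊆ : ∀ i → support (z i) ⊆ s)
           (Q-val : ∀ {f} → InjectiveOn s f → Q (λ i → val (z i) f)) where
    open Halves halves

    same-side : ∀ i j {f} → InjectiveOn s f → side (val (z i) f) ≡ side (val (z j) f)
    same-side i j f-inj = let b , h = split (Q-val f-inj) in trans (half-side h i) (sym (half-side h j))

    -- A labelling injective on the support of `z j` extends to all of `s` without changing the
    -- value of `z j`; there the relation holds and carries the side over from `z i`.
    decides-related : ∀ i j {σ b} → Valid σ → Decides σ (z i) b → Decides σ (z j) b
    decides-related i j {σ} valid dec x x-inj =
      let c = finToFun x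
          c′ , c′≈c , c′-inj =
            extend (support (z j)) s c (ℕ.≤-trans (ℕ.+-mono-≤ s≤ (small (z j))) k≤M) x-inj
          f-inj = extension-injective {σ} valid (λ p q → c′-inj (∈-++⁺ˡ p) (∈-++⁺ˡ q))
      in trans (cong side (local (z j) (extension-cong σ (sym ∘ c′≈c))))
           (trans (same-side j i f-inj)
             (decides {σ} {z i} dec (λ p q → c′-inj (∈-++⁺ˡ (z⊆ i p)) (∈-++⁺ˡ (z⊆ i q)))))

    good-related : ∀ i j x → Good (z i) x → Good (z j) x
    good-related i j x (valid , d) = let b , d = undecided (z i) x d in
      valid , decided (z j) x b (decides-related i j {seed x} valid d)

    choose-related : ∀ i j → choose (z i) ≡ choose (z j)
    choose-related i j = first-cong λ x →
      does-⇔ (mk⇔ (good-related i j x) (good-related j i x)) (good? (z i) x) (good? (z j) x)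

    -- All components choose the same seed. Since it decides `z zero`, every tuple to be averaged
    -- lies in the same half `b`, and this half is closed under the operation.
    value-of-preserves : Q (value-of ∘ z)
    value-of-preserves with some-good (z zero)
    ... | x₀ , x₀-good with first-found (does ∘ good? (z zero)) x₀ (dec-true (good? (z zero) x₀) x₀-good)
    ... | x , chosen , x-good = join (Closed.resp (half-closed b) agree averaged)
      where
      good : Good (z zero) x
      good = invert (subst (Reflects _) x-good (Dec.proof (good? (z zero) x)))
      valid = proj₁ good
      b = proj₁ (undecided (z zero) x (proj₂ good))
      side-b : Decides (seed x) (z zero) b
      side-b = proj₂ (undecided (z zero) x (proj₂ good))
      agree : ∀ i → average malcev k (val (z i) ∘ extension (seed x)) ≡ value-of (z i)
      agree i = cong (averageOver (z i)) (trans (sym chosen) (choose-related zero i))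
      in-half : ∀ {c} → InjectiveOn s c → half b (λ i → val (z i) (extension (seed x) c))
      in-half {c} c-inj =
        let b′ , h = split (Q-val (extension-injective {seed x} valid c-inj))
        in subst (λ b → half b _) (trans (sym (half-side h zero))
             (decides {seed x} {z zero} side-b (λ p q → c-inj (z⊆ zero p) (z⊆ zero q)))) h
      averaged : half b (λ i → average malcev k (val (z i) ∘ extension (seed x)))
      averaged = average-closed malcev k (ℕ.≤-trans s≤ (ℕ.m≤m+n k₀ k₀)) (half-closed b)
        (λ i c≈ → local (z i) (extension-cong (seed x) (c≈ ∘ z⊆ i))) in-half

-- Lifting a homomorphism to the pigeonhole graph

module Lifting (Γ₁ Γ₂ : FiniteGroup)
  (ψ : Reduction graphVocabulary (orVocabulary (cosetVocabulary Γ₁ 3) (cosetVocabulary Γ₂ 3)))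
  (h : Hom (reduce ψ K₃) OR[ Γ₁ ^[ 3 ] , Γ₂ ^[ 3 ] ])
  (P k₀ : ℕ) where

  open Reduction ψ
  open Interpretation interpretation
  open UnionGadget gadget
  open OrMalcev Γ₁ Γ₂
  open Averaging P k₀ malcev side c₁
  open Seeds P k using (N)
  open PigeonholeGraph P N
  open DatalogTransfer P N

  private
    Target = OR[ Γ₁ ^[ 3 ] , Γ₂ ^[ 3 ] ]
    G′  = interpret interpretation graph
    K₃′ = interpret interpretation K₃

  module _ (dim-small      : ∀ t → length (dim t) * 2 ≤ k₀)
           (relation-small : ∀ Q → length (concatMap dim (arity vocabulary Q)) * 2 ≤ k₀)
           (domain-fits    : ∀ t → Fits N (domain t))
           (relation-fits  : ∀ Q → Fits N (relation Q)) where

    lift : ∀ {t} (f : Fin P → Fin N) (z : Dom G′ t) → InjectiveOn (scopes (value z)) f → Dom K₃′ t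
    lift {t} f (x Refinement., p) f-inj =
      evalAll f x Refinement., Irrelevant.map (λ d → derivable-eval (domain-fits t) d f-inj) p

    element : ∀ {t} → Dom G′ t → Element
    element {t} z = record
      { support = scopes (value z)
      ; small   = ℕ.≤-trans (ℕ.≤-reflexive (length-scopes (value z))) (dim-small t)
      ; val     = val
      ; local   = local }
      where
      val : (Fin P → Fin N) → D
      val f with injectiveOn? (scopes (value z)) f
      ... | yes f-inj = Hom.fun h (inj (lift f z f-inj))
      -- A placeholder, which never enters a relation. Locality survives, because injectivity on the
      -- scopes is itself local.
      ... | no _      = c₁
      local : DependsOn (scopes (value z)) val
      local {f} {g} f≈g with injectiveOn? (scopes (value z)) f | injectiveOn? (scopes (value z)) g
      ... | yes f-inj | yes g-inj = cong (Hom.fun h ∘ inj) (refinement-≡ (evalAll-dependsOn (value z) f≈g))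
        where
        refinement-≡ : ∀ {u v : Dom K₃′ t} → value u ≡ value v → u ≡ v
        refinement-≡ refl = refl
      ... | yes f-inj | no ¬g-inj = ⊥-elim (¬g-inj (injectiveOn-resp f≈g f-inj))
      ... | no ¬f-inj | yes g-inj = ⊥-elim (¬f-inj (injectiveOn-resp (sym ∘ f≈g) g-inj))
      ... | no _      | no _      = refl

    val-injective : ∀ {t} (z : Dom G′ t) {f : Fin P → Fin N} (f-inj : InjectiveOn (scopes (value z)) f) →
                    Element.val (element z) f ≡ Hom.fun h (inj (lift f z f-inj))
    val-injective z {f} f-inj with injectiveOn? (scopes (value z)) f
    ... | yes _     = refl
    ... | no ¬f-inj = ⊥-elim (¬f-inj f-inj)

    tuple : ∀ {us} → All (Dom G′) us → All (λ _ → Vertex) (concatMap dim us)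
    tuple zs = concat⁺ (map⁺ (All.map value zs))

    scopes-++ : ∀ {us vs} (xs : All (λ _ → Vertex) us) (ys : All (λ _ → Vertex) vs) →
                scopes (++⁺ xs ys) ≡ scopes xs ++ scopes ys
    scopes-++ []       ys = refl
    scopes-++ (x ∷ xs) ys = cong (scope x ++_) (scopes-++ xs ys)

    evalAll-++ : ∀ {us vs} f (xs : All (λ _ → Vertex) us) (ys : All (λ _ → Vertex) vs) →
                 evalAll f (++⁺ xs ys) ≡ ++⁺ (evalAll f xs) (evalAll f ys)
    evalAll-++ f []       ys = refl
    evalAll-++ f (x ∷ xs) ys = cong (eval f x ∷_) (evalAll-++ f xs ys)

    head-scope : ∀ {u us} (z : Dom G′ u) (zs : All (Dom G′) us) → scopes (value z) ⊆ scopes (tuple (z ∷ zs))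
    head-scope z zs p = subst (_ ∈_) (sym (scopes-++ (value z) (tuple zs))) (∈-++⁺ˡ p)

    tail-scope : ∀ {u us} (z : Dom G′ u) (zs : All (Dom G′) us) → scopes (tuple zs) ⊆ scopes (tuple (z ∷ zs))
    tail-scope z zs p = subst (_ ∈_) (sym (scopes-++ (value z) (tuple zs))) (∈-++⁺ʳ (scopes (value z)) p)

    liftAll : ∀ {us} (f : Fin P → Fin N) (zs : All (Dom G′) us) →
              InjectiveOn (scopes (tuple zs)) f → All (Dom K₃′) us
    liftAll f []       _     = []
    liftAll f (z ∷ zs) f-inj =
      lift f z (λ p q → f-inj (head-scope z zs p) (head-scope z zs q)) ∷
      liftAll f zs (λ p q → f-inj (tail-scope z zs p) (tail-scope z zs q))

    value-liftAll : ∀ {us} (f : Fin P → Fin N) (zs : All (Dom G′) us)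
      (f-inj : InjectiveOn (scopes (tuple zs)) f) →
      concat⁺ (map⁺ (All.map value (liftAll f zs f-inj))) ≡ evalAll f (tuple zs)
    value-liftAll f []       _     = refl
    value-liftAll f (z ∷ zs) f-inj =
      trans (cong (++⁺ (evalAll f (value z))) (value-liftAll f zs _)) (sym (evalAll-++ f (value z) (tuple zs)))

    fun : Dom (reduce ψ graph) tt → D
    fun (inj z) = value-of (element z)

    component : ∀ {us} → All (Dom G′) us → Fin (length us) → Element
    component (z ∷ zs) zero    = element z
    component (z ∷ zs) (suc i) = component zs i

    component-scope : ∀ {us} (zs : All (Dom G′) us) i → Element.support (component zs i) ⊆ scopes (tuple zs)
    component-scope (z ∷ zs) zero    = head-scope z zs
    component-scope (z ∷ zs) (suc i) = tail-scope z zs ∘ component-scope zs i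

    valAll : ∀ {us} → (Fin P → Fin N) → All (Dom G′) us → All (λ _ → D) (map d us)
    valAll f []       = []
    valAll f (z ∷ zs) = Element.val (element z) f ∷ valAll f zs

    fun-liftAll : ∀ {us} (f : Fin P → Fin N) (zs : All (Dom G′) us)
      (f-inj : InjectiveOn (scopes (tuple zs)) f) →
                  All.map (Hom.fun h) (map⁺ (All.map inj (liftAll f zs f-inj))) ≡ valAll f zs
    fun-liftAll f []       _     = refl
    fun-liftAll f (z ∷ zs) f-inj = cong₂ _∷_
      (sym (val-injective z (λ p q → f-inj (head-scope z zs p) (head-scope z zs q)))) (fun-liftAll f zs _)

    gather : ∀ {us vs} {C : Structure vocabulary} →
             us ≡ map d vs → All (Dom C) vs → All (UnionDom gadget C) us
    gather eq zs = subst (All (UnionDom gadget _)) (sym eq) (map⁺ (All.map inj zs))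

    -- Stated for any list of sorts with the right image, since the equation of arities can be
    -- resolved only once the kind of `R` is known.
    transfer : ∀ R {us}
      (eq : arity (orVocabulary (cosetVocabulary Γ₁ 3) (cosetVocabulary Γ₂ 3)) R ≡ map d us)
      (zs : All (Dom G′) us) → length (scopes (tuple zs)) ≤ k₀ →
      (∀ {f} (f-inj : InjectiveOn (scopes (tuple zs)) f) →
         Rel Target R (All.map (Hom.fun h) (gather {C = K₃′} eq (liftAll f zs f-inj)))) →
      Rel Target R (All.map fun (gather {C = G′} eq zs))
    transfer R@(sym₁ X) {_ ∷ _ ∷ _ ∷ []} refl zs@(_ ∷ _ ∷ _ ∷ []) s≤ rel =
      value-of-preserves (sym₁-halves X) s≤ (component zs) (component-scope zs)
        (λ {f} f-inj → subst (Rel Target R) (fun-liftAll f zs f-inj) (rel f-inj))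
    transfer R@(sym₂ X) {_ ∷ _ ∷ _ ∷ []} refl zs@(_ ∷ _ ∷ _ ∷ []) s≤ rel =
      value-of-preserves (sym₂-halves X) s≤ (component zs) (component-scope zs)
        (λ {f} f-inj → subst (Rel Target R) (fun-liftAll f zs f-inj) (rel f-inj))
    transfer symS {_ ∷ _ ∷ []} refl zs@(_ ∷ _ ∷ []) s≤ rel =
      value-of-preserves symS-halves s≤ (component zs) (component-scope zs)
        (λ {f} f-inj → subst (Rel Target symS) (fun-liftAll f zs f-inj) (rel f-inj))

    lifted : Hom (reduce ψ graph) Target
    lifted = record
      { fun      = fun
      ; preserve = λ { _ _ (inj {Q} {zs} der) → transfer (ρ Q) (arity-ρ Q) zs
          (ℕ.≤-trans (ℕ.≤-reflexive (length-scopes (tuple zs))) (relation-small Q))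
          λ {f} f-inj → Hom.preserve h (ρ Q) _ (inj {Q = Q} {xs = liftAll f zs f-inj}
            (subst (Output K₃ (relation Q)) (sym (value-liftAll f zs f-inj))
              (derivable-eval (relation-fits Q) der f-inj))) } }

-- Choice of the parameters

max-bounds : ∀ {A : Set} → IsFiniteSet A → (f : A → ℕ) → ∃[ b ] ∀ a → f a ≤ b
max-bounds (n , A↔) f = max 0 (map (f ∘ from) (allFin n)) , λ a →
  subst (λ a → f a ≤ _) (strictlyInverseʳ a)
    (All.lookup (map⁻ (xs≤max 0 (map (f ∘ from) (allFin n)))) (∈-allFin (to a)))
  where open Inverse A↔

programSize : ∀ {S} {σ : Vocabulary S} {out} → Program σ out → ℕ
programSize p = max 0 (map (λ r → length (vars r) * 2 + length (arity₀ r) * 2) (rules p))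

programSize-fits : ∀ {S} {σ : Vocabulary S} {out n} (p : Program σ out) → programSize p ≤ n → Fits n p
programSize-fits p p≤n = All.map (λ r≤ → ℕ.≤-trans r≤ p≤n) (map⁻ (xs≤max 0 (map _ (rules p))))

K₃-irreducible : ∀ Γ₁ Γ₂ → ¬ DatalogUnionReducible K₃ OR[ Γ₁ ^[ 3 ] , Γ₂ ^[ 3 ] ]
K₃-irreducible Γ₁ Γ₂ (ψ , correct) =
  uncolourable ℕ.≤-refl (Equivalence.from (correct graph graph-finite)
    (Lifting.lifted Γ₁ Γ₂ ψ h (suc N) k₀
      (λ t → ℕ.≤-trans (dim≤ t) (ℕ.≤-trans (ℕ.m≤m+n a b) (ℕ.m≤m+n _ _)))
      (λ Q → ℕ.≤-trans (tuple≤ Q) (ℕ.≤-trans (ℕ.m≤n+m b a) (ℕ.m≤m+n _ _)))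
      (λ t → programSize-fits (domain t) (ℕ.≤-trans (domain≤ t) (ℕ.≤-trans (ℕ.m≤m+n c e) c+e≤N)))
      (λ Q → programSize-fits (relation Q) (ℕ.≤-trans (relation≤ Q) (ℕ.≤-trans (ℕ.m≤n+m e c) c+e≤N)))))
  where
  open Reduction ψ
  open Interpretation interpretation
  h : Hom (reduce ψ K₃) OR[ Γ₁ ^[ 3 ] , Γ₂ ^[ 3 ] ]
  -- `K₃` is a yes-instance by the identity; lifting `h` would make the uncolourable graph one too.
  h = Equivalence.to (correct K₃ K₃-finite)
    (record { fun = λ x → x ; preserve = λ { _ (_ ∷ _ ∷ []) x≢y → x≢y } })
  dim-bound = max-bounds sort-finite (λ t → length (dim t) * 2)
  tuple-bound = max-bounds symbol-finite (λ Q → length (concatMap dim (arity vocabulary Q)) * 2)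
  domain-bound = max-bounds sort-finite (λ t → programSize (domain t))
  relation-bound = max-bounds symbol-finite (λ Q → programSize (relation Q))
  a = proj₁ dim-bound
  b = proj₁ tuple-bound
  c = proj₁ domain-bound
  e = proj₁ relation-bound
  dim≤ = proj₂ dim-bound
  tuple≤ = proj₂ tuple-bound
  domain≤ = proj₂ domain-bound
  relation≤ = proj₂ relation-bound
  k₀ : ℕ
  -- One bound for the supports of elements, the supports of related tuples and the sizes of rules.
  k₀ = (a + b) + (c + e)
  -- The number of holes depends on `k₀` only, so it is computed with 0 as a dummy and then exceeded
  -- by the number `suc N` of pigeons.
  open Seeds 0 (k₀ + k₀) using (N)
  open PigeonholeGraph (suc N) N
  c+e≤N : c + e ≤ N
  c+e≤N = ℕ.≤-trans (ℕ.m≤n+m (c + e) (a + b)) (ℕ.≤-trans (ℕ.m≤m+n k₀ k₀)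
    (ℕ.≤-trans (k≤treeSize (k₀ + k₀)) (ℕ.m≤m+n (treeSize (k₀ + k₀)) _)))
lemma5p3 : ¬ DatalogUnionReducible K₃ OR[ ℤ/ 2 ^[ 3 ] , ℤ/ 3 ^[ 3 ] ]
lemma5p3 = K₃-irreducible (ℤ/ 2) (ℤ/ 3)
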